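{- Let $p$ be a prime number, $\alpha$ a positive integer, $P(n)$ a polynomial with integer coefficients, and let $(C_i)_{1\le i\le r}$, $(D_i)_{1\le i\le s}$, $(E_i)_{1\le i\le t}$, $(F_i)_{1\le i\le t}$ be integer sequences with $C_i>0$, $D_i>0$, $p\nmid\gcd(E_i,F_i)$ for all $i$, $\sum_{i=1}^rC_i=\sum_{i=1}^sD_i$, and $\{C_i:1\le i\le r\}\ne\{D_i:1\le i\le s\}$. Define \[ S(n):=\frac{P(n)}{\prod_{i=1}^t(E_in+F_i)}\cdot\frac{\prod_{i=1}^r(C_in)!}{\prod_{i=1}^s(D_in)!},\qquad n\ge0. \] If all elements of the sequence $(S(n))_{n\ge0}$ are integers, then \[ \lim_{N\to\infty}\frac1N\#\{0\le n<N:\ S(n)\equiv0 \pmod{p^\alpha}\}=1. \] -}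

module Defs where

open import Data.Nat as ℕ using (ℕ; zero; suc; _!)
open import Data.Integer as ℤ using (ℤ; +_)
open import Data.Fin using (Fin)
open import Data.List using (List; []; _∷_; map; allFin; filter; upTo; length; foldr)
open import Data.Product using (∃; _×_)
open import Data.Nat.Divisibility using (_∣?_)
open import Relation.Binary.PropositionalEquality using (_≡_)

evalPoly : List ℤ → ℤ → ℤ
evalPoly []       x = + 0
evalPoly (a ∷ as) x = a ℤ.+ x ℤ.* evalPoly as x

sumFin : ∀ r → (Fin r → ℕ) → ℕ
sumFin r f = foldr ℕ._+_ 0 (map f (allFin r))

prodFin : ∀ r → (Fin r → ℤ) → ℤ
prodFin r f = foldr ℤ._*_ (+ 1) (map f (allFin r))

SameSet : ∀ {r s} → (Fin r → ℕ) → (Fin s → ℕ) → Set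
SameSet {r} {s} C D = (∀ i → ∃ λ j → C i ≡ D j) × (∀ j → ∃ λ i → C i ≡ D j)

numer : List ℤ → ∀ r → (Fin r → ℕ) → ℕ → ℤ
numer P r C n = evalPoly P (+ n) ℤ.* prodFin r (λ i → + ((C i ℕ.* n) !))

denom : ∀ s → (Fin s → ℕ) → ∀ t → (Fin t → ℤ) → (Fin t → ℤ) → ℕ → ℤ
denom s D t E F n =
  prodFin t (λ i → E i ℤ.* (+ n) ℤ.+ F i) ℤ.* prodFin s (λ i → + ((D i ℕ.* n) !))

countDiv : ℕ → (ℕ → ℤ) → ℕ → ℕ
countDiv q S N = length (filter (λ n → q ∣? ℤ.∣ S n ∣) (upTo N))

{-# OPTIONS --safe #-}
-- For a prime p, Legendre's formula gives
--   v_p(S(n)) = v_p(P(n)) - Σ v_p(E_i n + F_i) + Σ_{l ≥ 1} Λ(n / p^l),   Λ(x) = Σ ⌊C_i x⌋ - Σ ⌊D_i x⌋.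
-- Integrality of S at large primes forces Λ ≥ 0 (unless P = 0), and since the sets differ, Λ(1/b) ≠ 0 for some b;
-- so Λ ≥ 1 on an interval to the right of 1/b, and modulo 1 because Σ C_i = Σ D_i. In base q = p^h, with q large, one
-- particular digit m puts the fractional part of n / q^(j+1) into that interval whenever it is the j-th digit of n.
-- Hence v_p(S(n)) is at least the number of digits m of n minus Σ v_p(E_i n + F_i). All but a small proportion of the n
-- have many digits m, by Markov's inequality for 2^(number of digits ≠ m), and p^M divides E_i n + F_i for at most one n
-- in each block of p^M consecutive integers.
module Submission where

open import Defs
open import Data.Nat as ℕ using (ℕ; zero; suc; _+_; _*_; _^_; _/_; _%_; _!; _≤_; _<_; _∸_; _⊓_; _≤?_; _<?_; _≟_; NonZero; z≤n; s≤s; s≤s⁻¹)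
open import Data.Nat.Properties
open import Data.Nat.DivMod
open import Data.Nat.Divisibility
open import Data.Nat.Primality using (Prime; euclidsLemma; prime⇒nonZero; prime⇒nonTrivial)
open import Data.Nat.GCD using (gcd; gcd-greatest)
open import Data.Nat.Tactic.RingSolver using (solve-∀)
open import Data.Integer as ℤ using (ℤ; +_)
open import Data.Fin using (Fin; zero; suc)
open import Data.List using (List; []; _∷_; foldr; length; filter; upTo; _∷ʳ_; _++_)
open import Data.List.Properties using (map-tabulate; upTo-∷ʳ; filter-++; length-++)
open import Data.Product using (∃; _×_; _,_; proj₁; proj₂)
open import Data.Sum using (_⊎_; inj₁; inj₂)
open import Data.Empty using (⊥)
open import Function using (_∘_; id)
open import Relation.Nullary using (¬_; Dec; yes; no; contradiction; ¬?)
open import Relation.Nullary.Decidable using (decidable-stable)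
open import Data.Fin.Properties using (any?)
open import Relation.Binary.PropositionalEquality using (_≡_; _≢_; refl; sym; trans; cong; cong₂; subst; module ≡-Reasoning)
open import Data.Nat.Primality.Factorisation using (factorise)
open import Data.List.Relation.Unary.All using (_∷_)
open import Data.Integer.Properties as ℤₚ using (abs-*; ∣i∣≡0⇒i≡0)
import Data.Integer.Tactic.RingSolver as ℤRing
open import Algebra.Properties.CommutativeSemigroup +-commutativeSemigroup using () renaming (interchange to +-interchange; xy∙z≈xz∙y to m+n+o≡m+o+n)
open import Algebra.Properties.CommutativeSemigroup *-commutativeSemigroup using () renaming (interchange to *-interchange; xy∙z≈xz∙y to m*n*o≡m*o*n; x∙yz≈y∙xz to m*[n*o]≡n*[m*o])
import Data.Integer.Divisibility.Signed as Signed
open import Relation.Binary.Definitions using (tri<; tri≈; tri>)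

-- Sums over initial segments of the natural numbers

∑< : ℕ → (ℕ → ℕ) → ℕ
∑< zero    g = 0
∑< (suc N) g = ∑< N g + g N

∑<-cong : ∀ N {f g} → (∀ n → f n ≡ g n) → ∑< N f ≡ ∑< N g
∑<-cong zero    eq = refl
∑<-cong (suc N) eq = cong₂ _+_ (∑<-cong N eq) (eq N)

∑<-mono : ∀ N {f g} → (∀ n → n < N → f n ≤ g n) → ∑< N f ≤ ∑< N g
∑<-mono zero    le = z≤n
∑<-mono (suc N) le = +-mono-≤ (∑<-mono N (λ n n<N → le n (m<n⇒m<1+n n<N))) (le N ≤-refl)

∑<-split : ∀ a b g → ∑< (a + b) g ≡ ∑< a g + ∑< b (λ n → g (a + n))
∑<-split a zero    g rewrite +-identityʳ a = sym (+-identityʳ _)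
∑<-split a (suc b) g rewrite +-suc a b =
  trans (cong (_+ g (a + b)) (∑<-split a b g)) (+-assoc (∑< a g) _ _)

∑<-suc : ∀ N g → ∑< (suc N) g ≡ g 0 + ∑< N (g ∘ suc)
∑<-suc N g = ∑<-split 1 N g

∑<-blocks : ∀ q Y g → ∑< (q * Y) g ≡ ∑< Y (λ n → ∑< q (λ d → g (q * n + d)))
∑<-blocks q zero    g rewrite *-zeroʳ q = refl
∑<-blocks q (suc Y) g = begin
  ∑< (q * suc Y) g                                   ≡⟨ cong (λ k → ∑< k g) (trans (*-suc q Y) (+-comm q (q * Y))) ⟩
  ∑< (q * Y + q) g                                   ≡⟨ ∑<-split (q * Y) q g ⟩
  ∑< (q * Y) g + ∑< q (λ d → g (q * Y + d))          ≡⟨ cong₂ _+_ (∑<-blocks q Y g) refl ⟩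
  ∑< (suc Y) (λ n → ∑< q (λ d → g (q * n + d)))      ∎
  where open ≡-Reasoning

∑<-monoˡ : ∀ {M N} g → M ≤ N → ∑< M g ≤ ∑< N g
∑<-monoˡ {M} {N} g M≤N = begin
  ∑< M g                                  ≤⟨ m≤m+n _ _ ⟩
  ∑< M g + ∑< (N ∸ M) (λ n → g (M + n))   ≡⟨ ∑<-split M (N ∸ M) g ⟨
  ∑< (M + (N ∸ M)) g                      ≡⟨ cong (λ k → ∑< k g) (m+[n∸m]≡n M≤N) ⟩
  ∑< N g                                  ∎
  where open ≤-Reasoning

∑<-const : ∀ N c → ∑< N (λ _ → c) ≡ N * c
∑<-const zero    c = refl
∑<-const (suc N) c = trans (cong (_+ c) (∑<-const N c)) (+-comm (N * c) c)

∑<-*ˡ : ∀ N c g → ∑< N (λ n → c * g n) ≡ c * ∑< N g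
∑<-*ˡ zero    c g = sym (*-zeroʳ c)
∑<-*ˡ (suc N) c g = trans (cong (_+ c * g N) (∑<-*ˡ N c g)) (sym (*-distribˡ-+ c (∑< N g) (g N)))

∑<-+ : ∀ N f g → ∑< N (λ n → f n + g n) ≡ ∑< N f + ∑< N g
∑<-+ zero    f g = refl
∑<-+ (suc N) f g = trans (cong (_+ (f N + g N)) (∑<-+ N f g)) (+-interchange (∑< N f) (∑< N g) (f N) (g N))

-- Finite families: sums, products and indicators

sumFin-suc : ∀ r f → sumFin (suc r) f ≡ f zero + sumFin r (f ∘ suc)
sumFin-suc r f = cong (λ l → f zero + foldr _+_ 0 l)
  (trans (map-tabulate suc f) (sym (map-tabulate id (f ∘ suc))))

prodFin-suc : ∀ r f → prodFin (suc r) f ≡ f zero ℤ.* prodFin r (f ∘ suc)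
prodFin-suc r f = cong (λ l → f zero ℤ.* foldr ℤ._*_ (+ 1) l)
  (trans (map-tabulate suc f) (sym (map-tabulate id (f ∘ suc))))

sumFin-mono : ∀ r {f g} → (∀ i → f i ≤ g i) → sumFin r f ≤ sumFin r g
sumFin-mono zero    le = z≤n
sumFin-mono (suc r) {f} {g} le rewrite sumFin-suc r f | sumFin-suc r g =
  +-mono-≤ (le zero) (sumFin-mono r (le ∘ suc))

sumFin-cong : ∀ r {f g} → (∀ i → f i ≡ g i) → sumFin r f ≡ sumFin r g
sumFin-cong r eq = ≤-antisym (sumFin-mono r (≤-reflexive ∘ eq)) (sumFin-mono r (≤-reflexive ∘ sym ∘ eq))

sumFin-strict : ∀ r {f g} → (∀ i → f i ≤ g i) → ∀ i → f i < g i → sumFin r f < sumFin r g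
sumFin-strict (suc r) {f} {g} le zero lt rewrite sumFin-suc r f | sumFin-suc r g =
  +-mono-<-≤ lt (sumFin-mono r (le ∘ suc))
sumFin-strict (suc r) {f} {g} le (suc i) lt rewrite sumFin-suc r f | sumFin-suc r g =
  +-mono-≤-< (le zero) (sumFin-strict r (le ∘ suc) i lt)

f[i]≤sumFin : ∀ r f i → f i ≤ sumFin r f
f[i]≤sumFin (suc r) f zero    rewrite sumFin-suc r f = m≤m+n _ _
f[i]≤sumFin (suc r) f (suc i) rewrite sumFin-suc r f =
  ≤-trans (f[i]≤sumFin r (f ∘ suc) i) (m≤n+m _ _)

sumFin-const : ∀ r c → sumFin r (λ _ → c) ≡ r * c
sumFin-const zero    c = refl
sumFin-const (suc r) c = trans (sumFin-suc r _) (cong (c ℕ.+_) (sumFin-const r c))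

sumFin-+ : ∀ r f g → sumFin r (λ i → f i + g i) ≡ sumFin r f + sumFin r g
sumFin-+ zero    f g = refl
sumFin-+ (suc r) f g
  rewrite sumFin-suc r (λ i → f i + g i) | sumFin-suc r f | sumFin-suc r g
        | sumFin-+ r (f ∘ suc) (g ∘ suc)
  = +-interchange (f zero) (g zero) _ _

sumFin-*ʳ : ∀ r f c → sumFin r (λ i → f i * c) ≡ sumFin r f * c
sumFin-*ʳ zero    f c = refl
sumFin-*ʳ (suc r) f c rewrite sumFin-suc r (λ i → f i * c) | sumFin-suc r f | sumFin-*ʳ r (f ∘ suc) c =
  sym (*-distribʳ-+ c (f zero) _)

sumFin-∑< : ∀ r K (f : Fin r → ℕ → ℕ) → sumFin r (λ i → ∑< K (f i)) ≡ ∑< K (λ l → sumFin r (λ i → f i l))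
sumFin-∑< r zero    f = trans (sumFin-const r 0) (*-zeroʳ r)
sumFin-∑< r (suc K) f = trans (sumFin-+ r _ _) (cong₂ _+_ (sumFin-∑< r K f) refl)

ind : {A : Set} → Dec A → ℕ
ind (yes _) = 1
ind (no _)  = 0

ind-mono : {A B : Set} (A? : Dec A) (B? : Dec B) → (A → B) → ind A? ≤ ind B?
ind-mono (yes a) (yes b) f = ≤-refl
ind-mono (yes a) (no ¬b) f = contradiction (f a) ¬b
ind-mono (no ¬a) B?      f = z≤n

ind-cong : {A B : Set} (A? : Dec A) (B? : Dec B) → (A → B) → (B → A) → ind A? ≡ ind B?
ind-cong A? B? f g = ≤-antisym (ind-mono A? B? f) (ind-mono B? A? g)

-- Bounds on p-adic valuations

-- The p-adic valuation of y is at most k, phrased as a cancellation property so that it is visibly multiplicative.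
ValuationAtMost : ℕ → ℕ → ℕ → Set
ValuationAtMost p k y = ∀ j x → p ^ (j + k) ∣ x * y → p ^ j ∣ x

atMost-* : ∀ {p a b y z} → ValuationAtMost p a y → ValuationAtMost p b z → ValuationAtMost p (a + b) (y * z)
atMost-* {p} {a} {b} {y} {z} hy hz j x d =
  hy j x (hz (j + a) (x * y) (subst (p ^ (j + a + b) ∣_) (sym (*-assoc x y z))
    (subst (λ e → p ^ e ∣ x * (y * z)) (sym (+-assoc j a b)) d)))

atMost-1 : ∀ {p} → ValuationAtMost p 0 1
atMost-1 {p} j x d rewrite +-identityʳ j | *-identityʳ x = d

^∣*∤⇒^∣ : ∀ {p} → Prime p → ∀ {y} → ¬ p ∣ y → ∀ a x → p ^ a ∣ x * y → p ^ a ∣ x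
^∣*∤⇒^∣ {p} pp {y} p∤y zero    x d = 1∣ x
^∣*∤⇒^∣ {p} pp {y} p∤y (suc a) x d with euclidsLemma x y pp (∣-trans (m∣m*n (p ^ a)) d)
... | inj₂ p∣y = contradiction p∣y p∤y
... | inj₁ (divides x′ refl) = subst (p ^ suc a ∣_) (*-comm p x′) (*-monoʳ-∣ p
        (^∣*∤⇒^∣ pp p∤y a x′ (*-cancelˡ-∣ p ⦃ prime⇒nonZero pp ⦄ (subst (p ^ suc a ∣_) (shuffle x′ p y) d))))
  where
  shuffle : ∀ a b c → (a * b) * c ≡ b * (a * c)
  shuffle = solve-∀

^-mono-∣ : ∀ p {a b} → a ≤ b → p ^ a ∣ p ^ b
^-mono-∣ p {a} {b} a≤b = subst (λ e → p ^ a ∣ p ^ e) (m+[n∸m]≡n a≤b)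
  (subst (p ^ a ∣_) (sym (^-distribˡ-+-* p a (b ∸ a))) (m∣m*n _))

-- Each factor `p` of `y` is cancelled on both sides while `M` drops by one; once `p` no longer
-- divides `y`, the whole remaining power passes to `x`.
∤⇒atMost : ∀ {p} → Prime p → ∀ M {y} → ¬ p ^ M ∣ y → ValuationAtMost p M y
∤⇒atMost pp zero    {y} nd j x d = contradiction (1∣ y) nd
∤⇒atMost {p} pp (suc M) {y} nd j x d with p ∣? y
... | no p∤y = ∣-trans (^-mono-∣ p (m≤m+n j (suc M))) (^∣*∤⇒^∣ pp p∤y (j + suc M) x d)
... | yes (divides y′ refl) = ∤⇒atMost pp M nd′ j x (*-cancelˡ-∣ p ⦃ prime⇒nonZero pp ⦄ d′)
  where
  nd′ : ¬ p ^ M ∣ y′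
  nd′ h = nd (subst (p ^ suc M ∣_) (*-comm p y′) (*-monoʳ-∣ p h))
  shuffle : ∀ a b c → a * (b * c) ≡ c * (a * b)
  shuffle = solve-∀
  d′ : p * p ^ (j + M) ∣ p * (x * y′)
  d′ = subst (_∣ p * (x * y′)) (cong (p ^_) (+-suc j M)) (subst (p ^ (j + suc M) ∣_) (shuffle x y′ p) d)

exact⇒atMost : ∀ {p} → Prime p → ∀ k {y} → p ^ k ∣ y → ¬ p ^ suc k ∣ y → ValuationAtMost p k y
exact⇒atMost {p} pp k (divides u refl) nd j x d =
  ^∣*∤⇒^∣ pp p∤u j x (*-cancelʳ-∣ (p ^ k) ⦃ m^n≢0 p k ⦃ prime⇒nonZero pp ⦄ ⦄
    (subst (_∣ x * u * p ^ k) (^-distribˡ-+-* p j k) (subst (p ^ (j + k) ∣_) (sym (*-assoc x u (p ^ k))) d)))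
  where
  p∤u : ¬ p ∣ u
  p∤u p∣u = nd (*-monoˡ-∣ (p ^ k) p∣u)

-- Integer quotients

/-unique : ∀ {n q} d .⦃ _ : NonZero d ⦄ → q * d ≤ n → n < suc q * d → n / d ≡ q
/-unique {n} {q} d lo hi = ≤-antisym (s≤s⁻¹ (m<n*o⇒m/o<n hi))
  (subst (_≤ n / d) (m*n/n≡m q d) (/-monoˡ-≤ d lo))

m<[1+m/n]*n : ∀ m n .⦃ _ : NonZero n ⦄ → m < suc (m / n) * n
m<[1+m/n]*n m n = subst (_< suc (m / n) * n) (sym (m≡m%n+[m/n]*n m n)) (+-monoˡ-< (m / n * n) (m%n<n m n))

suc-/-∣ : ∀ n d .⦃ _ : NonZero d ⦄ → d ∣ suc n → suc n / d ≡ suc (n / d)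
suc-/-∣ n d (divides e eq) = trans (trans (cong (_/ d) eq) (m*n/n≡m e d)) (lem e eq)
  where
  lem : ∀ e → suc n ≡ e * d → e ≡ suc (n / d)
  lem (suc e) eq = cong suc (sym (/-unique d
    (s≤s⁻¹ (subst (e * d <_) (sym eq) (+-monoˡ-≤ (e * d) (ℕ.>-nonZero⁻¹ d))))
    (subst (n <_) eq ≤-refl)))

suc-/-∤ : ∀ n d .⦃ _ : NonZero d ⦄ → ¬ d ∣ suc n → suc n / d ≡ n / d
suc-/-∤ n d nd = /-unique d (m≤n⇒m≤1+n (m/n*n≤m n d))
  (≤∧≢⇒< (m<[1+m/n]*n n d) (λ eq → nd (divides (suc (n / d)) eq)))

-- Legendre's formula, truncated at level `K`

module Legendre {p : ℕ} (pp : Prime p) where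

  p^≢0 : ∀ k → NonZero (p ^ k)
  p^≢0 k = m^n≢0 p k ⦃ prime⇒nonZero pp ⦄

  infixl 7 _/p^_
  _/p^_ : ℕ → ℕ → ℕ
  n /p^ l = _/_ n (p ^ l) ⦃ p^≢0 l ⦄

  legendre : ℕ → ℕ → ℕ
  legendre K n = ∑< K (λ l → n /p^ suc l)

  -- Passing from `n` to `suc n` raises the floor at level `l` exactly when `p ^ l` divides `suc n`.
  -- So `k` is the valuation of `suc n` capped at `K`; the alternative `k ≡ K` records that the cap
  -- may have been reached.
  legendre-suc : ∀ n K → ∃ λ k → k ≤ K × p ^ k ∣ suc n × (k ≡ K ⊎ ¬ p ^ suc k ∣ suc n)
                               × legendre K (suc n) ≡ k + legendre K n
  legendre-suc n zero = 0 , z≤n , 1∣ _ , inj₁ refl , refl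
  legendre-suc n (suc K) with legendre-suc n K | p ^ suc K ∣? suc n
  ... | k , k≤K , d , inj₂ nd , eq | yes d′ = contradiction (∣-trans (^-mono-∣ p (s≤s k≤K)) d′) nd
  ... | k , k≤K , d , inj₁ refl , eq | yes d′ = suc K , ≤-refl , d′ , inj₁ refl ,
        trans (cong₂ _+_ eq (suc-/-∣ n (p ^ suc K) ⦃ p^≢0 (suc K) ⦄ d′)) (shuffle K (legendre K n) (n /p^ suc K))
    where
    shuffle : ∀ a b c → (a + b) + suc c ≡ suc a + (b + c)
    shuffle = solve-∀
  ... | k , k≤K , d , ex , eq | no nd = k , m≤n⇒m≤1+n k≤K , d , inj₂ (exact ex) ,
        trans (cong₂ _+_ eq (suc-/-∤ n (p ^ suc K) ⦃ p^≢0 (suc K) ⦄ nd)) (+-assoc k _ _)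
    where
    exact : k ≡ K ⊎ ¬ p ^ suc k ∣ suc n → ¬ p ^ suc k ∣ suc n
    exact (inj₁ refl) = nd
    exact (inj₂ nd′)  = nd′

  legendre-0 : ∀ K → legendre K 0 ≡ 0
  legendre-0 zero    = refl
  legendre-0 (suc K) = cong₂ _+_ (legendre-0 K) (0/n≡0 (p ^ suc K) ⦃ p^≢0 (suc K) ⦄)

  ^legendre∣! : ∀ K n → p ^ legendre K n ∣ n !
  ^legendre∣! K zero rewrite legendre-0 K = ∣-refl
  ^legendre∣! K (suc n) with legendre-suc n K
  ... | k , _ , d , _ , eq rewrite eq | ^-distribˡ-+-* p k (legendre K n) = *-pres-∣ d (^legendre∣! K n)

  -- Every factor of `n !` is below `p ^ suc K`, hence not divisible by it, so truncation at `K`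
  -- loses nothing even where the cap is reached.
  !-atMost-legendre : ∀ K n → n < p ^ suc K → ValuationAtMost p (legendre K n) (n !)
  !-atMost-legendre K zero lt rewrite legendre-0 K = atMost-1
  !-atMost-legendre K (suc n) lt with legendre-suc n K
  ... | k , _ , d , ex , eq rewrite eq =
        atMost-* (exact⇒atMost pp k d (exact ex)) (!-atMost-legendre K n (<-trans ≤-refl lt))
    where
    exact : k ≡ K ⊎ ¬ p ^ suc k ∣ suc n → ¬ p ^ suc k ∣ suc n
    exact (inj₁ refl) = >⇒∤ lt
    exact (inj₂ nd)   = nd

-- Polynomials through finite differences

Δ : (ℕ → ℤ) → ℕ → ℤ
Δ f n = f (suc n) ℤ.- f n

-- Degree is encoded by the vanishing of the `d`-th difference, the form in which divisibility can
-- be carried from consecutive values to all values.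
DegreeBelow : ℕ → (ℕ → ℤ) → Set
DegreeBelow zero    f = ∀ n → f n ≡ + 0
DegreeBelow (suc d) f = DegreeBelow d (Δ f)

degreeBelow-cong : ∀ d {f g} → (∀ n → f n ≡ g n) → DegreeBelow d f → DegreeBelow d g
degreeBelow-cong zero    eq h n = trans (sym (eq n)) (h n)
degreeBelow-cong (suc d) eq h = degreeBelow-cong d (λ n → cong₂ ℤ._-_ (eq (suc n)) (eq n)) h

degreeBelow-suc : ∀ d {f} → DegreeBelow d f → DegreeBelow (suc d) f
degreeBelow-suc zero    h n = cong₂ ℤ._-_ (h (suc n)) (h n)
degreeBelow-suc (suc d) h = degreeBelow-suc d h

degreeBelow-+ : ∀ d {f g} → DegreeBelow d f → DegreeBelow d g → DegreeBelow d (λ n → f n ℤ.+ g n)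
degreeBelow-+ zero    hf hg n = cong₂ ℤ._+_ (hf n) (hg n)
degreeBelow-+ (suc d) {f} {g} hf hg =
  degreeBelow-cong d (λ n → sym (rearrange (f (suc n)) (g (suc n)) (f n) (g n))) (degreeBelow-+ d hf hg)
  where
  rearrange : ∀ a b c e → (a ℤ.+ b) ℤ.- (c ℤ.+ e) ≡ (a ℤ.- c) ℤ.+ (b ℤ.- e)
  rearrange = ℤRing.solve-∀

degreeBelow-const : ∀ d a → DegreeBelow (suc d) (λ _ → a)
degreeBelow-const zero    a n = ℤₚ.+-inverseʳ a
degreeBelow-const (suc d) a = degreeBelow-suc (suc d) {λ _ → a} (degreeBelow-const d a)

-- By the discrete Leibniz rule the difference of `x f` is `x Δf + (Δf + f)`, and induction applies
-- to the first summand.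
degreeBelow-x* : ∀ d {f} → DegreeBelow d f → DegreeBelow (suc d) (λ n → + n ℤ.* f n)
degreeBelow-x* zero {f} h = degreeBelow-suc 0 {λ n → + n ℤ.* f n} (λ n → trans (cong (+ n ℤ.*_) (h n)) (ℤₚ.*-zeroʳ (+ n)))
degreeBelow-x* (suc d) {f} h =
  degreeBelow-cong (suc d) (λ n → sym (leibniz (+ n) (f (suc n)) (f n)))
    (degreeBelow-+ (suc d) {λ n → + n ℤ.* Δ f n} (degreeBelow-x* d h)
      (degreeBelow-+ (suc d) {Δ f} {f} (degreeBelow-suc d {Δ f} h) h))
  where
  leibniz : ∀ x a b → (+ 1 ℤ.+ x) ℤ.* a ℤ.- x ℤ.* b ≡ x ℤ.* (a ℤ.- b) ℤ.+ ((a ℤ.- b) ℤ.+ b)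
  leibniz = ℤRing.solve-∀

degreeBelow-evalPoly : ∀ P → DegreeBelow (length P) (λ n → evalPoly P (+ n))
degreeBelow-evalPoly []      n = refl
degreeBelow-evalPoly (a ∷ P) =
  degreeBelow-+ (suc (length P)) {λ _ → a} (degreeBelow-const (length P) a)
    (degreeBelow-x* (length P) (degreeBelow-evalPoly P))

-- Induction on `d`: divisibility of `suc d` consecutive values of `f` gives it for `d` consecutive
-- values of `Δ f`, hence for all of them. Then all values of `f` agree modulo `q`, and one of them
-- is divisible.
∣consecutive⇒∣all : ∀ d {f} → DegreeBelow d f → ∀ q m → (∀ j → j < d → q Signed.∣ f (m + j)) → ∀ n → q Signed.∣ f n
∣consecutive⇒∣all zero    h q m hq n = subst (q Signed.∣_) (sym (h n)) (Signed.divides (+ 0) refl)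
∣consecutive⇒∣all (suc d) {f} h q m hq n =
  subst (q Signed.∣_) (telescope (f n) (f m) (f 0))
    (Signed.∣m∣n⇒∣m+n (Signed.∣m∣n⇒∣m-n (q∣f-f0 n) (q∣f-f0 m))
      (subst (λ k → q Signed.∣ f k) (+-identityʳ m) (hq 0 (s≤s z≤n))))
  where
  telescope : ∀ a b c → ((a ℤ.- c) ℤ.- (b ℤ.- c)) ℤ.+ b ≡ a
  telescope = ℤRing.solve-∀
  step : ∀ a b c → (a ℤ.- b) ℤ.+ (b ℤ.- c) ≡ a ℤ.- c
  step = ℤRing.solve-∀
  q∣Δf : ∀ n → q Signed.∣ Δ f n
  q∣Δf = ∣consecutive⇒∣all d h q m (λ j j<d → Signed.∣m∣n⇒∣m-n
    (subst (λ k → q Signed.∣ f k) (+-suc m j) (hq (suc j) (s≤s j<d))) (hq j (m<n⇒m<1+n j<d)))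
  q∣f-f0 : ∀ n → q Signed.∣ f n ℤ.- f 0
  q∣f-f0 zero    = Signed.divides (+ 0) (ℤₚ.+-inverseʳ (f 0))
  q∣f-f0 (suc n) = subst (q Signed.∣_) (step (f (suc n)) (f n) (f 0)) (Signed.∣m∣n⇒∣m+n (q∣Δf n) (q∣f-f0 n))

-- Euclid's argument: a prime factor of `B ! + 1` cannot be at most `B`.
prime-above : ∀ B → ∃ λ q → Prime q × B < q
prime-above B with factorise (suc (B !))
... | record { factors = [] ; isFactorisation = eq } =
      contradiction (suc-injective eq) (ℕ.≢-nonZero⁻¹ (B !) ⦃ B !≢0 ⦄)
... | record { factors = q ∷ qs ; isFactorisation = eq ; factorsPrime = pq ∷ _ } =
      q , pq , ≰⇒> λ q≤B → ¬q∣1 (∣m+n∣m⇒∣n (subst (q ∣_) (sym (trans (+-comm (B !) 1) eq)) (m∣m*n _)) (q∣B! q≤B))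
  where
  instance
    q≢0 : NonZero q
    q≢0 = prime⇒nonZero pq
  ¬q∣1 : ¬ q ∣ 1
  ¬q∣1 = >⇒∤ (ℕ.nonTrivial⇒n>1 q ⦃ prime⇒nonTrivial pq ⦄)
  q∣q! : ∀ q .⦃ _ : NonZero q ⦄ → q ∣ q !
  q∣q! (suc q) = m∣m*n (q !)
  q∣B! : q ≤ B → q ∣ B !
  q∣B! q≤B = ∣-trans (q∣q! q) (m≤n⇒m!∣n! q≤B)

-- Floors of multiples of a fraction

floor-mono : ∀ c {n m n′ m′} .⦃ _ : NonZero m ⦄ .⦃ _ : NonZero m′ ⦄ → n * m′ ≤ n′ * m → c * n / m ≤ c * n′ / m′
floor-mono c {n} {m} {n′} {m′} le = subst (_≤ c * n′ / m′) (m*n/n≡m k m′) (/-monoˡ-≤ m′ (*-cancelʳ-≤ _ _ m (begin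
  k * m′ * m      ≡⟨ m*n*o≡m*o*n k m′ m ⟩
  k * m * m′      ≤⟨ *-monoˡ-≤ m′ (m/n*n≤m (c * n) m) ⟩
  c * n * m′      ≡⟨ *-assoc c n m′ ⟩
  c * (n * m′)    ≤⟨ *-monoʳ-≤ c le ⟩
  c * (n′ * m)    ≡⟨ *-assoc c n′ m ⟨
  c * n′ * m      ∎)))
  where
  open ≤-Reasoning
  k = c * n / m

-- Right continuity of x ↦ ⌊c x⌋ at n / m: the hypothesis says that n′ / m′ < n / m + 1 / (c m).
floor-right-continuous : ∀ c {n m n′ m′} .⦃ _ : NonZero m ⦄ .⦃ _ : NonZero m′ ⦄ →
  c * n′ * m < suc (c * n) * m′ → c * n′ / m′ ≤ c * n / m
floor-right-continuous c {n} {m} {n′} {m′} lt = s≤s⁻¹ (m<n*o⇒m/o<n (*-cancelʳ-< m _ _ (begin-strict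
  c * n′ * m                  <⟨ lt ⟩
  suc (c * n) * m′            ≤⟨ *-monoˡ-≤ m′ (m<[1+m/n]*n (c * n) m) ⟩
  suc (c * n / m) * m * m′    ≡⟨ m*n*o≡m*o*n (suc (c * n / m)) m m′ ⟩
  suc (c * n / m) * m′ * m    ∎)))
  where
  open ≤-Reasoning

floorSum : ∀ r → (Fin r → ℕ) → ℕ → (m : ℕ) → .⦃ NonZero m ⦄ → ℕ
floorSum r C n m = sumFin r (λ i → C i * n / m)

^sumFin∣∣prodFin∣ : ∀ p r {e : Fin r → ℕ} {f : Fin r → ℤ} → (∀ i → p ^ e i ∣ ℤ.∣ f i ∣) → p ^ sumFin r e ∣ ℤ.∣ prodFin r f ∣
^sumFin∣∣prodFin∣ p zero    h = ∣-refl
^sumFin∣∣prodFin∣ p (suc r) {e} {f} h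
  rewrite sumFin-suc r e | prodFin-suc r f | abs-* (f zero) (prodFin r (f ∘ suc))
        | ^-distribˡ-+-* p (e zero) (sumFin r (e ∘ suc))
  = *-pres-∣ (h zero) (^sumFin∣∣prodFin∣ p r (h ∘ suc))

∣prodFin∣-atMost : ∀ p r {e : Fin r → ℕ} {f : Fin r → ℤ} → (∀ i → ValuationAtMost p (e i) ℤ.∣ f i ∣) →
  ValuationAtMost p (sumFin r e) ℤ.∣ prodFin r f ∣
∣prodFin∣-atMost p zero    h = atMost-1
∣prodFin∣-atMost p (suc r) {e} {f} h
  rewrite sumFin-suc r e | prodFin-suc r f | abs-* (f zero) (prodFin r (f ∘ suc))
  = atMost-* (h zero) (∣prodFin∣-atMost p r (h ∘ suc))

-- Sums of floors determine the set of coefficients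

atLeast : ∀ r → (Fin r → ℕ) → ℕ → ℕ
atLeast r C b = sumFin r (λ i → ind (b ≤? C i))

∑<-ind-≤ : ∀ M x → ∑< M (λ k → ind (suc k ≤? x)) ≡ M ⊓ x
∑<-ind-≤ zero    x = refl
∑<-ind-≤ (suc M) x with suc M ≤? x
... | yes M<x = trans (cong (_+ 1) (trans (∑<-ind-≤ M x) (m≤n⇒m⊓n≡m (<⇒≤ M<x)))) (trans (+-comm M 1) (sym (m≤n⇒m⊓n≡m M<x)))
... | no  M≮x = trans (+-identityʳ _) (trans (∑<-ind-≤ M x)
      (trans (m≥n⇒m⊓n≡n (≮⇒≥ M≮x)) (sym (m≥n⇒m⊓n≡n (m≤n⇒m≤1+n (≮⇒≥ M≮x))))))

-- The quotient `c / b` counts the multiples `b, 2b, 3b, ...` that are at most `c`; the bound `M`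
-- makes the range of summation the same for all coefficients.
floor-layer-cake : ∀ M c b .⦃ _ : NonZero b ⦄ → c ≤ M → c * 1 / b ≡ ∑< M (λ k → ind (b * suc k ≤? c))
floor-layer-cake M c b c≤M = begin
  c * 1 / b                              ≡⟨ cong (_/ b) (*-identityʳ c) ⟩
  c / b                                  ≡⟨ m≥n⇒m⊓n≡n (≤-trans (m/n≤m c b) c≤M) ⟨
  M ⊓ (c / b)                            ≡⟨ ∑<-ind-≤ M (c / b) ⟨
  ∑< M (λ k → ind (suc k ≤? c / b))      ≡⟨ ∑<-cong M (λ k → ind-cong (suc k ≤? c / b) (b * suc k ≤? c) (to k) (from k)) ⟩
  ∑< M (λ k → ind (b * suc k ≤? c))      ∎
  where
  open ≡-Reasoning
  to : ∀ k → suc k ≤ c / b → b * suc k ≤ c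
  to k le = subst (_≤ c) (*-comm (suc k) b) (≤-trans (*-monoˡ-≤ b le) (m/n*n≤m c b))
  from : ∀ k → b * suc k ≤ c → suc k ≤ c / b
  from k le = subst (_≤ c / b) (trans (cong (_/ b) (*-comm b (suc k))) (m*n/n≡m (suc k) b)) (/-monoˡ-≤ b le)

floorSum-layer-cake : ∀ M r C b .⦃ _ : NonZero b ⦄ → (∀ i → C i ≤ M) →
  floorSum r C 1 b ≡ ∑< M (λ k → atLeast r C (b * suc k))
floorSum-layer-cake M r C b C≤M =
  trans (sumFin-cong r (λ i → floor-layer-cake M (C i) b (C≤M i))) (sumFin-∑< r M (λ i k → ind (b * suc k ≤? C i)))

atLeast-large : ∀ {M} r C b → (∀ i → C i ≤ M) → M < b → atLeast r C b ≡ 0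
atLeast-large r C b C≤M M<b = trans (sumFin-cong r zero′) (trans (sumFin-const r 0) (*-zeroʳ r))
  where
  zero′ : ∀ i → ind (b ≤? C i) ≡ 0
  zero′ i with b ≤? C i
  ... | yes b≤C = contradiction (<-≤-trans M<b (≤-trans b≤C (C≤M i))) (<-irrefl refl)
  ... | no _    = refl

-- In the layer cake for b only atLeast at b itself and at proper multiples of b occur, so downward induction on b applies.
floorSums⇒atLeast : ∀ M r s C D → (∀ i → C i ≤ M) → (∀ i → D i ≤ M) →
  (∀ b → suc b ≤ M → floorSum r C 1 (suc b) ≡ floorSum s D 1 (suc b)) →
  ∀ e b → M < suc b + e → atLeast r C (suc b) ≡ atLeast s D (suc b)
floorSums⇒atLeast M r s C D C≤M D≤M eq zero    b M<b =
  trans (atLeast-large r C (suc b) C≤M M<b′) (sym (atLeast-large s D (suc b) D≤M M<b′))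
  where M<b′ = subst (M <_) (+-identityʳ (suc b)) M<b
floorSums⇒atLeast zero r s C D C≤M D≤M eq (suc e) b M<b =
  trans (atLeast-large r C (suc b) C≤M (s≤s z≤n)) (sym (atLeast-large s D (suc b) D≤M (s≤s z≤n)))
floorSums⇒atLeast M@(suc M′) r s C D C≤M D≤M eq (suc e) b M<b with suc b ≤? M
... | no  M<sb = trans (atLeast-large r C (suc b) C≤M (≰⇒> M<sb)) (sym (atLeast-large s D (suc b) D≤M (≰⇒> M<sb)))
... | yes sb≤M = subst (λ x → atLeast r C x ≡ atLeast s D x) (*-identityʳ (suc b)) (+-cancelʳ-≡ _ _ _ (begin
  layer r C 0 + ∑< M′ (layer r C ∘ suc)    ≡⟨ ∑<-suc M′ (layer r C) ⟨
  ∑< M (layer r C)                         ≡⟨ floorSum-layer-cake M r C (suc b) C≤M ⟨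
  floorSum r C 1 (suc b)                   ≡⟨ eq b sb≤M ⟩
  floorSum s D 1 (suc b)                   ≡⟨ floorSum-layer-cake M s D (suc b) D≤M ⟩
  ∑< M (layer s D)                         ≡⟨ ∑<-suc M′ (layer s D) ⟩
  layer s D 0 + ∑< M′ (layer s D ∘ suc)    ≡⟨ cong₂ _+_ refl (∑<-cong M′ (λ k → sym (multiples k))) ⟩
  layer s D 0 + ∑< M′ (layer r C ∘ suc)    ∎))
  where
  open ≡-Reasoning
  layer : ∀ r → (Fin r → ℕ) → ℕ → ℕ
  layer r C k = atLeast r C (suc b * suc k)
  multiples : ∀ k → layer r C (suc k) ≡ layer s D (suc k)
  -- `suc b * suc (suc k)` unfolds to the successor of the argument given here. It exceeds `suc b`
  -- by at least one, which pays for lowering the fuel from `suc e` to `e`.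
  multiples k = floorSums⇒atLeast M r s C D C≤M D≤M eq e (suc k + b * suc (suc k))
    (≤-trans M<b (subst (_≤ suc (suc k + b * suc (suc k)) + e) (sym (+-suc (suc b) e))
      (+-monoˡ-≤ e (s≤s (s≤s (≤-trans (m≤m*n b (suc (suc k))) (m≤n+m _ k)))))))

-- The count for `C` drops strictly between the thresholds `C i` and `suc (C i)`, whereas the count
-- for `D` could not drop there if no `D j` were equal to `C i`.
∈-of-atLeast : ∀ r s (C : Fin r → ℕ) (D : Fin s → ℕ) → (∀ b → 0 < b → atLeast r C b ≡ atLeast s D b) →
  ∀ i → 0 < C i → ∃ λ j → D j ≡ C i
∈-of-atLeast r s C D eq i 0<Ci with any? (λ j → D j ≟ C i)
... | yes found = found
... | no  none  = contradiction (trans (eq (suc (C i)) (s≤s z≤n)) (trans (sym same) (sym (eq (C i) 0<Ci)))) (<⇒≢ jump)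
  where
  same : atLeast s D (C i) ≡ atLeast s D (suc (C i))
  same = sumFin-cong s (λ j → ind-cong (C i ≤? D j) (suc (C i) ≤? D j)
    (λ le → ≤∧≢⇒< le (λ Ci≡Dj → none (j , sym Ci≡Dj))) <⇒≤)
  strict : ind (suc (C i) ≤? C i) < ind (C i ≤? C i)
  strict with suc (C i) ≤? C i | C i ≤? C i
  ... | yes lt | _      = contradiction lt (<-irrefl refl)
  ... | no _   | yes _  = s≤s z≤n
  ... | no _   | no nle = contradiction ≤-refl nle
  jump : atLeast r C (suc (C i)) < atLeast r C (C i)
  jump = sumFin-strict r (λ k → ind-mono (suc (C i) ≤? C k) (C i ≤? C k) <⇒≤) i strict

-- A bounded search yields the witness: the common sum `M` bounds every `C i` and `D i`, so
-- agreement of the floor sums for all denominators up to `M` already forces equal sets.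
∃floorSum≢ : ∀ r s (C : Fin r → ℕ) (D : Fin s → ℕ) → (∀ i → 0 < C i) → (∀ i → 0 < D i) →
  sumFin r C ≡ sumFin s D → ¬ SameSet C D →
  ∃ λ b → floorSum r C 1 (suc b) ≢ floorSum s D 1 (suc b)
∃floorSum≢ r s C D C>0 D>0 ΣC≡ΣD ≠set
  with anyUpTo? (λ b → ¬? (floorSum r C 1 (suc b) ≟ floorSum s D 1 (suc b))) (sumFin r C)
... | yes (b , _ , neq) = b , neq
... | no none = contradiction
      ( (λ i → let j , e = ∈-of-atLeast r s C D eq i (C>0 i) in j , sym e)
      , (λ j → ∈-of-atLeast s r D C (λ b b>0 → sym (eq b b>0)) j (D>0 j))) ≠set
  where
  M = sumFin r C
  floors : ∀ b → suc b ≤ M → floorSum r C 1 (suc b) ≡ floorSum s D 1 (suc b)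
  floors b b<M = decidable-stable (_ ≟ _) (λ neq → none (b , b<M , neq))
  eq : ∀ b → 0 < b → atLeast r C b ≡ atLeast s D b
  eq (suc b) _ = floorSums⇒atLeast M r s C D (f[i]≤sumFin r C)
    (λ i → subst (D i ≤_) (sym ΣC≡ΣD) (f[i]≤sumFin s D i)) floors M b (s≤s (m≤n+m M b))

-- Floor sums and base-q digits

m<n^m : ∀ n → 1 < n → ∀ m → m < n ^ m
m<n^m n 1<n zero    = s≤s z≤n
m<n^m n 1<n (suc m) = begin
  suc (suc m)      ≤⟨ s≤s (m<n^m n 1<n m) ⟩
  suc (n ^ m)      ≤⟨ +-monoˡ-≤ (n ^ m) (≤-trans (s≤s z≤n) (m<n^m n 1<n m)) ⟩
  n ^ m + n ^ m    ≡⟨ cong (n ^ m ℕ.+_) (+-identityʳ (n ^ m)) ⟨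
  2 * n ^ m        ≤⟨ *-monoˡ-≤ (n ^ m) 1<n ⟩
  n * n ^ m        ∎
  where open ≤-Reasoning

-- Splitting off the integer part of `n / X` costs only the sum of the coefficients, so for equal
-- coefficient sums the difference of two floor sums depends on the fractional part alone.
floorSum-% : ∀ r C n X .⦃ _ : NonZero X ⦄ → floorSum r C n X ≡ sumFin r C * (n / X) + floorSum r C (n % X) X
floorSum-% r C n X = trans (sumFin-cong r step) (trans (sumFin-+ r _ _) (cong₂ _+_ (sumFin-*ʳ r C (n / X)) refl))
  where
  open ≡-Reasoning
  expand : ∀ c a e X → c * (a + e * X) ≡ c * e * X + c * a
  expand = solve-∀
  step : ∀ i → C i * n / X ≡ C i * (n / X) + C i * (n % X) / X
  step i = begin
    C i * n / X                                   ≡⟨ cong (λ k → C i * k / X) (m≡m%n+[m/n]*n n X) ⟩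
    C i * (n % X + n / X * X) / X                 ≡⟨ cong (_/ X) (expand (C i) (n % X) (n / X) X) ⟩
    (C i * (n / X) * X + C i * (n % X)) / X       ≡⟨ +-distrib-/-∣ˡ (C i * (n % X)) (n∣m*n (C i * (n / X))) ⟩
    C i * (n / X) * X / X + C i * (n % X) / X     ≡⟨ cong (_+ C i * (n % X) / X) (m*n/n≡m (C i * (n / X)) X) ⟩
    C i * (n / X) + C i * (n % X) / X             ∎

-- If the leading digit of the fractional part of n / (q Q) is ⌊q / b⌋ + 1, that fractional part lies just to the right of 1 / b.
floorSum-digit : ∀ r s C D → sumFin r C ≡ sumFin s D → ∀ b .⦃ _ : NonZero b ⦄ → floorSum s D 1 b < floorSum r C 1 b →
  ∀ q Q X n .⦃ _ : NonZero q ⦄ .⦃ _ : NonZero Q ⦄ .⦃ _ : NonZero X ⦄ → X ≡ q * Q → 2 * b * sumFin s D < q →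
  (n / Q) % q ≡ suc (q / b) → floorSum s D n X < floorSum r C n X
floorSum-digit r s C D ΣC≡ΣD b gap q Q .(q * Q) n refl large digit = begin-strict
  floorSum s D n X                             ≡⟨ floorSum-% s D n X ⟩
  sumFin s D * (n / X) + floorSum s D n₀ X     ≤⟨ +-monoʳ-≤ (sumFin s D * (n / X)) (sumFin-mono s (λ i → floor-right-continuous (D i) {1} {b} {n₀} {X} (upper i))) ⟩
  sumFin s D * (n / X) + floorSum s D 1 b      <⟨ +-monoʳ-< (sumFin s D * (n / X)) gap ⟩
  sumFin s D * (n / X) + floorSum r C 1 b      ≤⟨ +-monoʳ-≤ (sumFin s D * (n / X)) (sumFin-mono r (λ i → floor-mono (C i) {1} {b} {n₀} {X} lower)) ⟩
  sumFin s D * (n / X) + floorSum r C n₀ X     ≡⟨ cong (λ k → k * (n / X) + floorSum r C n₀ X) ΣC≡ΣD ⟨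
  sumFin r C * (n / X) + floorSum r C n₀ X     ≡⟨ floorSum-% r C n X ⟨
  floorSum r C n X                             ∎
  where
  open ≤-Reasoning
  X = q * Q
  n₀ = n % X
  m = suc (q / b)
  n₀/Q : n₀ / Q ≡ m
  n₀/Q = trans (m%[n*o]/o≡m/o%n n q Q ⦃ _ ⦄ ⦃ _ ⦄ ⦃ m*n≢0 q Q ⦄) digit
  expand : ∀ d k b Q → d * (suc (suc k) * Q) * b ≡ 2 * b * d * Q + d * (k * b * Q)
  expand = solve-∀
  assoc : ∀ d q Q → q * Q + d * (q * Q) ≡ suc (d * 1) * (q * Q)
  assoc = solve-∀
  lower : 1 * X ≤ n₀ * b
  lower = begin
    1 * X               ≡⟨ *-identityˡ X ⟩
    q * Q               ≤⟨ *-monoˡ-≤ Q (<⇒≤ (m<[1+m/n]*n q b)) ⟩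
    m * b * Q           ≡⟨ m*n*o≡m*o*n m b Q ⟩
    m * Q * b           ≡⟨ cong (λ k → k * Q * b) n₀/Q ⟨
    n₀ / Q * Q * b      ≤⟨ *-monoˡ-≤ b (m/n*n≤m n₀ Q) ⟩
    n₀ * b              ∎
  upper : ∀ i → D i * n₀ * b < suc (D i * 1) * X
  -- Here `n₀ < (m + 1) Q` with `m + 1 = q / b + 2`. The 2 beyond `q / b` contributes `2 b (D i) Q`,
  -- which `large` keeps below `q Q`.
  upper i = begin-strict
    D i * n₀ * b                                       ≤⟨ *-monoˡ-≤ b (*-monoʳ-≤ (D i) (<⇒≤ (m<[1+m/n]*n n₀ Q))) ⟩
    D i * (suc (n₀ / Q) * Q) * b                       ≡⟨ cong (λ k → D i * (suc k * Q) * b) n₀/Q ⟩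
    D i * (suc m * Q) * b                              ≡⟨ expand (D i) (q / b) b Q ⟩
    2 * b * D i * Q + D i * (q / b * b * Q)            ≤⟨ +-monoʳ-≤ (2 * b * D i * Q) (*-monoʳ-≤ (D i) (*-monoˡ-≤ Q (m/n*n≤m q b))) ⟩
    2 * b * D i * Q + D i * (q * Q)                    <⟨ +-monoˡ-< (D i * (q * Q)) (*-monoˡ-< Q (≤-<-trans (*-monoʳ-≤ (2 * b) (f[i]≤sumFin s D i)) large)) ⟩
    q * Q + D i * (q * Q)                              ≡⟨ assoc (D i) q Q ⟩
    suc (D i * 1) * X                                  ∎

-- The range is cut into `B` blocks of length `suc h′` and a remainder of length `e`; the gain `g j`
-- is made at the last place of block `j`, the level whose modulus is a power of `q`.
∑<-block-gain : ∀ {h′ : ℕ} {c d : ℕ → ℕ} (g : ℕ → ℕ) → (∀ l → d l ≤ c l) →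
  (∀ j → d (suc h′ * j + h′) + g j ≤ c (suc h′ * j + h′)) →
  ∀ B e → ∑< (suc h′ * B + e) d + ∑< B g ≤ ∑< (suc h′ * B + e) c
∑<-block-gain {h′} {c} {d} g d≤c gain B e = begin
  ∑< (h * B + e) d + ∑< B g                                 ≡⟨ cong (_+ ∑< B g) (∑<-split (h * B) e d) ⟩
  (∑< (h * B) d + rest d) + ∑< B g                          ≡⟨ m+n+o≡m+o+n (∑< (h * B) d) (rest d) (∑< B g) ⟩
  (∑< (h * B) d + ∑< B g) + rest d                          ≡⟨ cong (λ k → (k + ∑< B g) + rest d) (∑<-blocks h B d) ⟩
  (∑< B (block d) + ∑< B g) + rest d                        ≡⟨ cong (_+ rest d) (∑<-+ B (block d) g) ⟨
  ∑< B (λ j → block d j + g j) + rest d                     ≤⟨ +-mono-≤ (∑<-mono B (λ j _ → block-≤ j)) (∑<-mono e (λ n _ → d≤c (h * B + n))) ⟩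
  ∑< B (block c) + rest c                                   ≡⟨ cong (_+ rest c) (∑<-blocks h B c) ⟨
  ∑< (h * B) c + rest c                                     ≡⟨ ∑<-split (h * B) e c ⟨
  ∑< (h * B + e) c                                          ∎
  where
  open ≤-Reasoning
  h = suc h′
  rest : (ℕ → ℕ) → ℕ
  rest f = ∑< e (λ n → f (h * B + n))
  block : (ℕ → ℕ) → ℕ → ℕ
  block f j = ∑< h (λ a → f (h * j + a))
  block-≤ : ∀ j → block d j + g j ≤ block c j
  block-≤ j = subst (_≤ block c j) (sym (+-assoc (∑< h′ (λ a → d (h * j + a))) _ _))
    (+-mono-≤ (∑<-mono h′ (λ a _ → d≤c (h * j + a))) (gain j))

-- Exponential growth, counting and density

^-distribʳ-* : ∀ k a b → (a * b) ^ k ≡ a ^ k * b ^ k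
^-distribʳ-* zero    a b = refl
^-distribʳ-* (suc k) a b = trans (cong (a * b *_) (^-distribʳ-* k a b)) (*-interchange a b (a ^ k) (b ^ k))

-- Bernoulli's inequality `(1 + 1/x)^B ≥ 1 + B/x`, cleared of denominators.
bernoulli : ∀ x B → x ^ B * (x + B) ≤ x * suc x ^ B
bernoulli x zero    = ≤-reflexive (trans (*-identityˡ (x + 0)) (trans (+-identityʳ x) (sym (*-identityʳ x))))
bernoulli x (suc B) = begin
  x * x ^ B * (x + suc B)                 ≤⟨ m≤m+n _ (x ^ B * B) ⟩
  x * x ^ B * (x + suc B) + x ^ B * B     ≡⟨ regroup x (x ^ B) B ⟩
  suc x * (x ^ B * (x + B))               ≤⟨ *-monoʳ-≤ (suc x) (bernoulli x B) ⟩
  suc x * (x * suc x ^ B)                 ≡⟨ m*[n*o]≡n*[m*o] (suc x) x (suc x ^ B) ⟩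
  x * (suc x * suc x ^ B)                 ∎
  where
  open ≤-Reasoning
  regroup : ∀ x y B → x * y * (x + suc B) + y * B ≡ suc x * (y * (x + B))
  regroup = solve-∀

exponential-wins : ∀ x .⦃ _ : NonZero x ⦄ c → ∃ λ B → c * x ^ B ≤ suc x ^ B
-- For `B = c x` Bernoulli's lower bound is `1 + c`.
exponential-wins x c = c * x , *-cancelˡ-≤ x (begin
  x * (c * x ^ B)      ≡⟨ swap x c (x ^ B) ⟩
  x ^ B * (c * x)      ≤⟨ *-monoʳ-≤ (x ^ B) (m≤n+m B x) ⟩
  x ^ B * (x + B)      ≤⟨ bernoulli x B ⟩
  x * suc x ^ B        ∎)
  where
  open ≤-Reasoning
  B = c * x
  swap : ∀ a b e → a * (b * e) ≡ e * (b * a)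
  swap = solve-∀

∑<-ind≤1 : ∀ {A : ℕ → Set} (A? : ∀ n → Dec (A n)) Q → (∀ {a b} → a < b → b < Q → A a → A b → ⊥) → ∑< Q (λ n → ind (A? n)) ≤ 1
∑<-ind≤1 A? zero    unique = z≤n
∑<-ind≤1 A? (suc Q) unique with A? Q
... | no _   = subst (_≤ 1) (sym (+-identityʳ _)) (∑<-ind≤1 A? Q (λ a<b b<Q → unique a<b (m<n⇒m<1+n b<Q)))
... | yes aQ = ≤-reflexive (cong (_+ 1) (n≤0⇒n≡0 (≤-trans (∑<-mono Q none) (≤-reflexive (trans (∑<-const Q 0) (*-zeroʳ Q))))))
  where
  none : ∀ n → n < Q → ind (A? n) ≤ 0
  none n n<Q with A? n
  ... | yes an = contradiction aQ (unique n<Q ≤-refl an)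
  ... | no _   = z≤n

count-complement : ∀ {A : ℕ → Set} (A? : ∀ n → Dec (A n)) N → length (filter A? (upTo N)) + ∑< N (λ n → ind (¬? (A? n))) ≡ N
count-complement A? zero    = refl
count-complement A? (suc N) = begin
  length (filter A? (upTo (suc N))) + (∑< N no? + no? N)         ≡⟨ cong (λ l → length (filter A? l) + (∑< N no? + no? N)) (upTo-∷ʳ N) ⟨
  length (filter A? (upTo N ∷ʳ N)) + (∑< N no? + no? N)          ≡⟨ cong (λ l → length l + (∑< N no? + no? N)) (filter-++ A? (upTo N) (N ∷ [])) ⟩
  length (filter A? (upTo N) ++ filter A? (N ∷ [])) + (∑< N no? + no? N)  ≡⟨ cong (_+ (∑< N no? + no? N)) (length-++ (filter A? (upTo N))) ⟩
  (count + last) + (∑< N no? + no? N)                            ≡⟨ +-interchange count last (∑< N no?) (no? N) ⟩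
  (count + ∑< N no?) + (last + no? N)                            ≡⟨ cong₂ _+_ (count-complement A? N) last-or-not ⟩
  N + 1                                                          ≡⟨ +-comm N 1 ⟩
  suc N                                                          ∎
  where
  open ≡-Reasoning
  no? : ℕ → ℕ
  no? n = ind (¬? (A? n))
  count = length (filter A? (upTo N))
  last  = length (filter A? (N ∷ []))
  last-or-not : last + no? N ≡ 1
  last-or-not with A? N
  ... | yes _ = refl
  ... | no _  = refl

-- Rounding `N` up to a multiple of `Q` adds at most `Q ≤ N`, which accounts for the factor 2.
block-density⇒density : ∀ κ Q .⦃ _ : NonZero Q ⦄ g → (∀ Y → κ * ∑< (Q * Y) g ≤ Q * Y) →
  ∀ N → Q ≤ N → κ * ∑< N g ≤ 2 * N
block-density⇒density κ Q g bound N Q≤N = begin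
  κ * ∑< N g             ≤⟨ *-monoʳ-≤ κ (∑<-monoˡ g (<⇒≤ (subst (N <_) (*-comm Y Q) (m<[1+m/n]*n N Q)))) ⟩
  κ * ∑< (Q * Y) g       ≤⟨ bound Y ⟩
  Q * Y                  ≡⟨ *-comm Q Y ⟩
  Q + N / Q * Q          ≤⟨ +-mono-≤ Q≤N (m/n*n≤m N Q) ⟩
  N + N                  ≡⟨ cong (N ℕ.+_) (+-identityʳ N) ⟨
  2 * N                  ∎
  where
  open ≤-Reasoning
  Y = suc (N / Q)

-- Rarity of numbers with few digits `m`

module Digits (q : ℕ) ⦃ q≢0 : NonZero q ⦄ (m : ℕ) (m<q : m < q) where

  digit : ℕ → ℕ → ℕ
  digit n j = _/_ n (q ^ j) ⦃ m^n≢0 q j ⦄ % q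

  digit-suc : ∀ n j → digit n (suc j) ≡ digit (n / q) j
  digit-suc n j = cong (_% q) (sym (m/n/o≡m/[n*o] n q (q ^ j) ⦃ _ ⦄ ⦃ m^n≢0 q j ⦄ ⦃ m^n≢0 q (suc j) ⦄))

  occurrences : ℕ → ℕ → ℕ
  occurrences B n = ∑< B (λ j → ind (digit n j ≟ m))

  digitWeight : ℕ → ℕ
  digitWeight d = suc (ind (¬? (d ≟ m)))

  -- The Markov weight: 2 to the number of digits ≠ m among the B lowest digits of n.
  weight : ℕ → ℕ → ℕ
  weight zero    n = 1
  weight (suc B) n = weight B (n / q) * digitWeight (n % q)

  -- Each digit contributes a factor 2 to exactly one of the two terms: to the power of two if it is
  -- `m`, to the weight otherwise.
  weight-occurrences : ∀ B n → weight B n * 2 ^ occurrences B n ≡ 2 ^ B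
  weight-occurrences zero    n = refl
  weight-occurrences (suc B) n = begin
    weight B n′ * digitWeight (n % q) * 2 ^ occurrences (suc B) n   ≡⟨ cong (λ e → weight B n′ * digitWeight (n % q) * 2 ^ e) split ⟩
    weight B n′ * digitWeight (n % q) * 2 ^ (o + occurrences B n′)  ≡⟨ cong (weight B n′ * digitWeight (n % q) *_) (^-distribˡ-+-* 2 o (occurrences B n′)) ⟩
    weight B n′ * digitWeight (n % q) * (2 ^ o * 2 ^ occurrences B n′)  ≡⟨ regroup (weight B n′) (digitWeight (n % q)) (2 ^ o) (2 ^ occurrences B n′) ⟩
    (digitWeight (n % q) * 2 ^ o) * (weight B n′ * 2 ^ occurrences B n′)  ≡⟨ cong₂ _*_ two (weight-occurrences B n′) ⟩
    2 ^ suc B                                                       ∎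
    where
    open ≡-Reasoning
    n′ = n / q
    o = ind (n % q ≟ m)
    split : occurrences (suc B) n ≡ o + occurrences B n′
    split = trans (∑<-suc B (λ j → ind (digit n j ≟ m))) (cong₂ _+_ (cong (λ k → ind (k % q ≟ m)) (n/1≡n n))
      (∑<-cong B (λ j → cong (λ k → ind (k ≟ m)) (digit-suc n j))))
    regroup : ∀ a b c d → a * b * (c * d) ≡ (b * c) * (a * d)
    regroup = solve-∀
    two : digitWeight (n % q) * 2 ^ o ≡ 2
    two with n % q ≟ m
    ... | yes _ = refl
    ... | no _  = refl

  -- The total weight of a single digit position: 1 for the digit `m` and 2 for each of the other
  -- `q - 1` digits.
  x = ℕ.pred (2 * q)

  suc-x : suc x ≡ 2 * q
  suc-x = suc-pred (2 * q) ⦃ m*n≢0 2 q ⦄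

  digitWeight-sum : ∑< q digitWeight ≤ x
  digitWeight-sum = s≤s⁻¹ (begin
    suc (∑< q digitWeight)               ≡⟨ +-comm 1 _ ⟩
    ∑< q digitWeight + 1                 ≤⟨ +-monoʳ-≤ (∑< q digitWeight) one ⟩
    ∑< q digitWeight + ∑< q is-m         ≡⟨ ∑<-+ q digitWeight is-m ⟨
    ∑< q (λ d → digitWeight d + is-m d)  ≡⟨ ∑<-cong q two ⟩
    ∑< q (λ _ → 2)                       ≡⟨ ∑<-const q 2 ⟩
    q * 2                                ≡⟨ *-comm q 2 ⟩
    2 * q                                ≡⟨ suc-x ⟨
    suc x                                ∎)
    where
    open ≤-Reasoning
    is-m : ℕ → ℕ
    is-m d = ind (d ≟ m)
    two : ∀ d → digitWeight d + is-m d ≡ 2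
    two d with d ≟ m
    ... | yes _ = refl
    ... | no _  = refl
    is-m-m : is-m m ≡ 1
    is-m-m with m ≟ m
    ... | yes _   = refl
    ... | no m≢m  = contradiction refl m≢m
    one : 1 ≤ ∑< q is-m
    one = ≤-trans (subst (_≤ ∑< (suc m) is-m) is-m-m (m≤n+m (is-m m) (∑< m is-m))) (∑<-monoˡ is-m m<q)

  -- The weight is a product over digits. Writing the argument as `q n + d` and summing over the
  -- lowest digit `d` first splits off a factor of at most `x`.
  weight-sum : ∀ B Y → ∑< (q ^ B * Y) (weight B) ≤ x ^ B * Y
  weight-sum zero    Y = ≤-reflexive (trans (∑<-const (1 * Y) 1) (*-identityʳ (1 * Y)))
  weight-sum (suc B) Y = begin
    ∑< (q * q ^ B * Y) (weight (suc B))                    ≡⟨ cong (λ k → ∑< k (weight (suc B))) (*-assoc q (q ^ B) Y) ⟩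
    ∑< (q * (q ^ B * Y)) (weight (suc B))                  ≡⟨ ∑<-blocks q (q ^ B * Y) (weight (suc B)) ⟩
    ∑< (q ^ B * Y) (λ n → ∑< q (λ d → weight (suc B) (q * n + d)))  ≤⟨ ∑<-mono (q ^ B * Y) (λ n _ → block n) ⟩
    ∑< (q ^ B * Y) (λ n → x * weight B n)                  ≡⟨ ∑<-*ˡ (q ^ B * Y) x (weight B) ⟩
    x * ∑< (q ^ B * Y) (weight B)                          ≤⟨ *-monoʳ-≤ x (weight-sum B Y) ⟩
    x * (x ^ B * Y)                                        ≡⟨ *-assoc x (x ^ B) Y ⟨
    x ^ suc B * Y                                          ∎
    where
    open ≤-Reasoning
    form : ∀ n d → q * n + d ≡ d + n * q
    form n d = trans (+-comm (q * n) d) (cong (d ℕ.+_) (*-comm q n))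
    pointwise : ∀ n d → d < q → weight (suc B) (q * n + d) ≡ weight B n * digitWeight d
    pointwise n d d<q = cong₂ (λ a b → weight B a * digitWeight b)
      (/-unique q (subst (_≤ q * n + d) (*-comm q n) (m≤m+n (q * n) d))
        (subst (_< suc n * q) (sym (form n d)) (+-monoˡ-< (n * q) d<q)))
      (trans (cong (_% q) (form n d)) (trans ([m+kn]%n≡m%n d n q) (m<n⇒m%n≡m d<q)))
    block : ∀ n → ∑< q (λ d → weight (suc B) (q * n + d)) ≤ x * weight B n
    block n = begin
      ∑< q (λ d → weight (suc B) (q * n + d))    ≤⟨ ∑<-mono q (λ d d<q → ≤-reflexive (pointwise n d d<q)) ⟩
      ∑< q (λ d → weight B n * digitWeight d)    ≡⟨ ∑<-*ˡ q (weight B n) digitWeight ⟩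
      weight B n * ∑< q digitWeight              ≤⟨ *-monoʳ-≤ (weight B n) digitWeight-sum ⟩
      weight B n * x                             ≡⟨ *-comm (weight B n) x ⟩
      x * weight B n                             ∎

  -- Markov's inequality: the mean weight is at most `(x / q) ^ B`, while fewer than `T` digits `m`
  -- force a weight of at least `2 ^ B / 2 ^ T`.
  few-occurrences-rare : ∀ κ T → ∃ λ B → ∀ Y → κ * ∑< (q ^ B * Y) (λ n → ind (occurrences B n <? T)) ≤ q ^ B * Y
  -- Since `suc x` equals `2 q`, the proportion is at most `2 ^ T (x / suc x) ^ B`; `B` is chosen to
  -- bring this below `1 / κ`.
  few-occurrences-rare κ T with exponential-wins x ⦃ ℕ.>-nonZero x>0 ⦄ (κ * 2 ^ T)
    where
    x>0 : 0 < x
    x>0 = s≤s⁻¹ (subst (2 ≤_) (sym suc-x) (m≤m*n 2 q))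
  ... | B , win = B , λ Y → *-cancelˡ-≤ (2 ^ B) ⦃ m^n≢0 2 B ⦄ (bound Y)
    where
    open ≤-Reasoning
    few : ℕ → ℕ
    few n = ind (occurrences B n <? T)
    markov : ∀ n → 2 ^ B * few n ≤ 2 ^ T * weight B n
    markov n with occurrences B n <? T
    ... | no _   = ≤-trans (≤-reflexive (*-zeroʳ (2 ^ B))) z≤n
    ... | yes lt = begin
      2 ^ B * 1                                ≡⟨ *-identityʳ (2 ^ B) ⟩
      2 ^ B                                    ≡⟨ weight-occurrences B n ⟨
      weight B n * 2 ^ occurrences B n         ≤⟨ *-monoʳ-≤ (weight B n) (^-monoʳ-≤ 2 (<⇒≤ lt)) ⟩
      weight B n * 2 ^ T                       ≡⟨ *-comm (weight B n) (2 ^ T) ⟩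
      2 ^ T * weight B n                       ∎
    regroup : ∀ a b c d → a * (b * (c * d)) ≡ a * b * c * d
    regroup = solve-∀
    bound : ∀ Y → 2 ^ B * (κ * ∑< (q ^ B * Y) few) ≤ 2 ^ B * (q ^ B * Y)
    bound Y = begin
      2 ^ B * (κ * ∑< (q ^ B * Y) few)                 ≡⟨ m*[n*o]≡n*[m*o] (2 ^ B) κ _ ⟩
      κ * (2 ^ B * ∑< (q ^ B * Y) few)                 ≡⟨ cong (κ *_) (∑<-*ˡ (q ^ B * Y) (2 ^ B) few) ⟨
      κ * ∑< (q ^ B * Y) (λ n → 2 ^ B * few n)         ≤⟨ *-monoʳ-≤ κ (∑<-mono (q ^ B * Y) (λ n _ → markov n)) ⟩
      κ * ∑< (q ^ B * Y) (λ n → 2 ^ T * weight B n)    ≡⟨ cong (κ *_) (∑<-*ˡ (q ^ B * Y) (2 ^ T) (weight B)) ⟩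
      κ * (2 ^ T * ∑< (q ^ B * Y) (weight B))          ≤⟨ *-monoʳ-≤ κ (*-monoʳ-≤ (2 ^ T) (weight-sum B Y)) ⟩
      κ * (2 ^ T * (x ^ B * Y))                        ≡⟨ regroup κ (2 ^ T) (x ^ B) Y ⟩
      κ * 2 ^ T * x ^ B * Y                            ≤⟨ *-monoˡ-≤ Y win ⟩
      suc x ^ B * Y                                    ≡⟨ cong (λ k → k ^ B * Y) suc-x ⟩
      (2 * q) ^ B * Y                                  ≡⟨ cong (_* Y) (^-distribʳ-* B 2 q) ⟩
      2 ^ B * q ^ B * Y                                ≡⟨ *-assoc (2 ^ B) (q ^ B) Y ⟩
      2 ^ B * (q ^ B * Y)                              ∎

-- Multiples of prime powers among values of a linear form

-- Two hits at distance `a` give `Q ∣ a E`. A hit also excludes `p ∣ E`, since `p` would then divide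
-- `F` as well; the positive exponent `suc M` is what puts `p` into `Q`. So `Q ∣ a`, and a block of
-- length `Q` has at most one hit.
linear-multiples-rare : ∀ {p} → Prime p → ∀ E F → ¬ p ∣ gcd ℤ.∣ E ∣ ℤ.∣ F ∣ → ∀ M Y →
  ∑< (p ^ suc M * Y) (λ n → ind (p ^ suc M ∣? ℤ.∣ E ℤ.* (+ n) ℤ.+ F ∣)) ≤ Y
linear-multiples-rare {p} pp E F p∤gcd M Y = begin
  ∑< (Q * Y) hit                                  ≡⟨ ∑<-blocks Q Y hit ⟩
  ∑< Y (λ n → ∑< Q (λ d → hit (Q * n + d)))       ≤⟨ ∑<-mono Y (λ n _ → ∑<-ind≤1 (λ d → Q ∣? value (Q * n + d)) Q (unique n)) ⟩
  ∑< Y (λ _ → 1)                                  ≡⟨ ∑<-const Y 1 ⟩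
  Y * 1                                           ≡⟨ *-identityʳ Y ⟩
  Y                                               ∎
  where
  open ≤-Reasoning
  Q = p ^ suc M
  value : ℕ → ℕ
  value n = ℤ.∣ E ℤ.* (+ n) ℤ.+ F ∣
  hit : ℕ → ℕ
  hit n = ind (Q ∣? value n)

  p∤E : ∀ {n} → Q ∣ value n → ¬ p ∣ ℤ.∣ E ∣
  p∤E {n} Q∣ p∣E = p∤gcd (gcd-greatest p∣E (Signed.∣⇒∣ᵤ (Signed.∣m+n∣m⇒∣n {+ p} {E ℤ.* (+ n)}
    (Signed.∣ᵤ⇒∣ (∣-trans (m∣m*n (p ^ M)) Q∣)) (Signed.∣m⇒∣m*n {m = E} (+ n) (Signed.∣ᵤ⇒∣ p∣E)))))

  difference : ∀ e x a f → (e ℤ.* (x ℤ.+ a) ℤ.+ f) ℤ.- (e ℤ.* x ℤ.+ f) ≡ a ℤ.* e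
  difference = ℤRing.solve-∀

  Q∣difference : ∀ n a → Q ∣ value n → Q ∣ value (n + a) → Q ∣ a
  Q∣difference n a hn hna = ^∣*∤⇒^∣ pp (p∤E {n} hn) (suc M) a (subst (Q ∣_) (abs-* (+ a) E)
    (Signed.∣⇒∣ᵤ (subst (+ Q Signed.∣_) (difference E (+ n) (+ a) F)
      (Signed.∣m∣n⇒∣m-n (Signed.∣ᵤ⇒∣ {+ Q} {E ℤ.* (+ (n + a)) ℤ.+ F} hna) (Signed.∣ᵤ⇒∣ hn)))))

  unique : ∀ n {a b} → a < b → b < Q → Q ∣ value (Q * n + a) → Q ∣ value (Q * n + b) → ⊥
  unique n {a} {b} a<b b<Q ha hb = >⇒∤ ⦃ ℕ.>-nonZero (m<n⇒0<n∸m a<b) ⦄ (≤-<-trans (m∸n≤m b a) b<Q)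
    (Q∣difference (Q * n + a) (b ∸ a) ha (subst (λ k → Q ∣ value k) (sym shift) hb))
    where
    shift : Q * n + a + (b ∸ a) ≡ Q * n + b
    shift = trans (+-assoc (Q * n) a (b ∸ a)) (cong (Q * n ℕ.+_) (m+[n∸m]≡n (<⇒≤ a<b)))

-- Integrality: Landau's criterion and the valuation of `S`

∣prodFin∣≢0 : ∀ r {f : Fin r → ℤ} → (∀ i → f i ≢ + 0) → ℤ.∣ prodFin r f ∣ ≢ 0
∣prodFin∣≢0 zero    h ()
∣prodFin∣≢0 (suc r) {f} h eq
  with m*n≡0⇒m≡0∨n≡0 ℤ.∣ f zero ∣ (trans (sym (trans (cong ℤ.∣_∣ (prodFin-suc r f)) (abs-* (f zero) _))) eq)
... | inj₁ f0≡0 = h zero (∣i∣≡0⇒i≡0 f0≡0)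
... | inj₂ rest = ∣prodFin∣≢0 r (h ∘ suc) rest

-- Integrality is expressed by the type of `S` together with the cross-multiplied identity `S-eq`,
-- so no division of integers occurs.
module IntegralQuotient (P : List ℤ) (r s t : ℕ) (C : Fin r → ℕ) (D : Fin s → ℕ) (E F : Fin t → ℤ)
  (S : ℕ → ℤ) (S-eq : ∀ n → S n ℤ.* denom s D t E F n ≡ numer P r C n)
  (linear≢0 : ∀ n i → E i ℤ.* (+ n) ℤ.+ F i ≢ + 0) where

  linear : Fin t → ℕ → ℤ
  linear i n = E i ℤ.* (+ n) ℤ.+ F i

  ∣∏linear∣ ∣∏C!∣ ∣∏D!∣ ∣P∣ : ℕ → ℕ
  ∣∏linear∣ n = ℤ.∣ prodFin t (λ i → linear i n) ∣
  ∣∏C!∣ n     = ℤ.∣ prodFin r (λ i → + ((C i * n) !)) ∣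
  ∣∏D!∣ n     = ℤ.∣ prodFin s (λ i → + ((D i * n) !)) ∣
  ∣P∣ n       = ℤ.∣ evalPoly P (+ n) ∣

  abs-eq : ∀ n → ℤ.∣ S n ∣ * (∣∏linear∣ n * ∣∏D!∣ n) ≡ ∣P∣ n * ∣∏C!∣ n
  abs-eq n = begin
    ℤ.∣ S n ∣ * (∣∏linear∣ n * ∣∏D!∣ n)    ≡⟨ cong (ℤ.∣ S n ∣ *_) (abs-* (prodFin t (λ i → linear i n)) _) ⟨
    ℤ.∣ S n ∣ * ℤ.∣ denom s D t E F n ∣    ≡⟨ abs-* (S n) _ ⟨
    ℤ.∣ S n ℤ.* denom s D t E F n ∣        ≡⟨ cong ℤ.∣_∣ (S-eq n) ⟩
    ℤ.∣ numer P r C n ∣                    ≡⟨ abs-* (evalPoly P (+ n)) _ ⟩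
    ∣P∣ n * ∣∏C!∣ n                        ∎
    where open ≡-Reasoning

  -- Below `q ^ 2` a single floor per factorial is its full valuation, so the numerator factorials
  -- fall short of the denominator by at least one factor `q`, which only `P` can supply.
  q∣P : ∀ {q} (pq : Prime q) n → (∀ i → C i * n < q ^ 2) →
    floorSum r C n (q ^ 1) ⦃ Legendre.p^≢0 pq 1 ⦄ < floorSum s D n (q ^ 1) ⦃ Legendre.p^≢0 pq 1 ⦄ → q ^ 1 ∣ ∣P∣ n
  q∣P {q} pq n small lt =
    ∣prodFin∣-atMost q r (λ i → !-atMost-legendre 1 (C i * n) (small i)) 1 (∣P∣ n)
      (subst (q ^ suc (floorSum r C n (q ^ 1)) ∣_) (abs-eq n)
        (∣n⇒∣m*n ℤ.∣ S n ∣ (∣n⇒∣m*n (∣∏linear∣ n)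
          (∣-trans (^-mono-∣ q lt) (^sumFin∣∣prodFin∣ q s (λ i → ^legendre∣! 1 (D i * n)))))))
    where
    open Legendre pq
    instance
      q^1≢0 : NonZero (q ^ 1)
      q^1≢0 = p^≢0 1

  -- Landau's criterion: a negative value of Σ⌊C x⌋ - Σ⌊D x⌋ at n / m persists to the right of n / m, so for a large
  -- prime q it forces q to divide P at length P consecutive places, hence everywhere.
  landau : ∀ {x₀} → ∣P∣ x₀ ≢ 0 → ∀ n m .⦃ _ : NonZero m ⦄ → floorSum s D n m ≤ floorSum r C n m
  landau {x₀} P≢0 n m = ≮⇒≥ contra
    where
    d = length P
    c = sumFin r C
    -- For a prime `q` above `B`, the first term prevents `q` from dividing the nonzero value at
    -- `x₀`, the second keeps the window where the floors of `C` do not grow, and the third keeps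
    -- `C i * n′` below `q ^ 2`.
    B = ∣P∣ x₀ + (c * (d * m) + suc (c * n))

    contra : ¬ floorSum r C n m < floorSum s D n m
    contra lt with prime-above B
    ... | q , pq , B<q = >⇒∤ ⦃ ℕ.≢-nonZero P≢0 ⦄ (≤-<-trans (m≤m+n _ _) B<q)
                           (Signed.∣⇒∣ᵤ (∣consecutive⇒∣all d (degreeBelow-evalPoly P) (+ q) (suc (n * q / m)) q∣window x₀))
      where
      open ≤-Reasoning
      instance
        q^1≢0 : NonZero (q ^ 1)
        q^1≢0 = Legendre.p^≢0 pq 1
        q≢0 : NonZero q
        q≢0 = prime⇒nonZero pq

      module _ (j : ℕ) (j<d : j < d) where
        -- The `d` consecutive integers just above `n q / m`, so that `n′ / q` exceeds `n / m` by at
        -- most `d / q`.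
        n′ = suc (n * q / m) + j

        n/m≤n′/q : n * q ≤ n′ * m
        n/m≤n′/q = ≤-trans (<⇒≤ (m<[1+m/n]*n (n * q) m)) (*-monoˡ-≤ m (m≤m+n (suc (n * q / m)) j))

        n′m≤ : n′ * m ≤ n * q + d * m
        n′m≤ = begin
          n′ * m                           ≡⟨ cong (_* m) (sym (+-suc (n * q / m) j)) ⟩
          (n * q / m + suc j) * m          ≡⟨ *-distribʳ-+ m (n * q / m) (suc j) ⟩
          n * q / m * m + suc j * m        ≤⟨ +-mono-≤ (m/n*n≤m (n * q) m) (*-monoˡ-≤ m j<d) ⟩
          n * q + d * m                    ∎

        n′/q<n/m+1/Cm : ∀ i → C i * n′ * m < suc (C i * n) * q
        n′/q<n/m+1/Cm i = begin-strict
          C i * n′ * m                     ≡⟨ *-assoc (C i) n′ m ⟩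
          C i * (n′ * m)                   ≤⟨ *-monoʳ-≤ (C i) n′m≤ ⟩
          C i * (n * q + d * m)            ≡⟨ expand (C i) n q (d * m) ⟩
          C i * (d * m) + C i * n * q      ≤⟨ +-monoˡ-≤ _ (*-monoˡ-≤ (d * m) (f[i]≤sumFin r C i)) ⟩
          c * (d * m) + C i * n * q        <⟨ +-monoˡ-< _ (≤-<-trans (≤-trans (m≤m+n _ _) (m≤n+m _ (∣P∣ x₀))) B<q) ⟩
          suc (C i * n) * q                ∎
          where
          expand : ∀ a n q e → a * (n * q + e) ≡ a * e + a * n * q
          expand = solve-∀

        Cn′<q² : ∀ i → C i * n′ < q ^ 2
        Cn′<q² i = begin-strict
          C i * n′             ≤⟨ m≤m*n (C i * n′) m ⟩
          C i * n′ * m         <⟨ n′/q<n/m+1/Cm i ⟩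
          suc (C i * n) * q    ≤⟨ *-monoˡ-≤ q (<⇒≤ (≤-<-trans (≤-trans (s≤s (*-monoˡ-≤ n (f[i]≤sumFin r C i)))
                                    (≤-trans (m≤n+m _ (c * (d * m))) (m≤n+m _ (∣P∣ x₀)))) B<q)) ⟩
          q * q                ≡⟨ cong (q *_) (sym (*-identityʳ q)) ⟩
          q ^ 2                ∎

        q∣P[n′] : q ^ 1 ∣ ∣P∣ n′
        q∣P[n′] = q∣P pq n′ Cn′<q² (begin-strict
          floorSum r C n′ (q ^ 1)   ≤⟨ sumFin-mono r (λ i → floor-right-continuous (C i) {n} {m} {n′} {q ^ 1}
                                         (subst (λ k → C i * n′ * m < suc (C i * n) * k) (sym (*-identityʳ q)) (n′/q<n/m+1/Cm i))) ⟩
          floorSum r C n m          <⟨ lt ⟩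
          floorSum s D n m          ≤⟨ sumFin-mono s (λ i → floor-mono (D i) {n} {m} {n′} {q ^ 1}
                                         (subst (λ k → n * k ≤ n′ * m) (sym (*-identityʳ q)) n/m≤n′/q)) ⟩
          floorSum s D n′ (q ^ 1)   ∎)

      q∣window : ∀ j → j < d → (+ q) Signed.∣ evalPoly P (+ (suc (n * q / m) + j))
      q∣window j j<d = Signed.∣ᵤ⇒∣ (subst (_∣ ∣P∣ (n′ j j<d)) (*-identityʳ q) (q∣P[n′] j j<d))

  P≡0⇒S≡0 : ∀ n → ∣P∣ n ≡ 0 → ℤ.∣ S n ∣ ≡ 0
  P≡0⇒S≡0 n P≡0 with m*n≡0⇒m≡0∨n≡0 ℤ.∣ S n ∣ (trans (abs-eq n) (cong (_* ∣∏C!∣ n) P≡0))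
  ... | inj₁ S≡0 = S≡0
  ... | inj₂ den≡0 with m*n≡0⇒m≡0∨n≡0 (∣∏linear∣ n) den≡0
  ...   | inj₁ lin≡0 = contradiction lin≡0 (∣prodFin∣≢0 t (linear≢0 n))
  ...   | inj₂ D!≡0  = contradiction D!≡0 (∣prodFin∣≢0 s (λ i eq → ℕ.≢-nonZero⁻¹ ((D i * n) !) ⦃ (D i * n) !≢0 ⦄ (ℤₚ.+-injective eq)))

  bad : ℕ → ℕ → ℕ
  bad Q n = ind (¬? (Q ∣? ℤ.∣ S n ∣))

  N∸countDiv : ∀ Q N → N ∸ countDiv Q S N ≡ ∑< N (bad Q)
  N∸countDiv Q N = trans (cong (_∸ count) (sym (count-complement (λ n → Q ∣? ℤ.∣ S n ∣) N))) (m+n∸m≡n count (∑< N (bad Q)))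
    where count = countDiv Q S N

  ∤S⇒P≢0 : ∀ {Q n} → ¬ Q ∣ ℤ.∣ S n ∣ → ∣P∣ n ≢ 0
  ∤S⇒P≢0 {Q} {n} nd P≡0 = nd (subst (Q ∣_) (sym (P≡0⇒S≡0 n P≡0)) (Q ∣0))

  module _ {p : ℕ} (pp : Prime p) where
    open Legendre pp

    -- The linear factors cost at most `M` each and the factorials of the denominator exactly their
    -- sums truncated at `K`, by the size condition. The truncated sums bound the valuation of the
    -- numerator from below, and exchanging summations turns both into sums over levels.
    excess⇒^∣S : ∀ α M K n → (∀ i → ¬ p ^ M ∣ ℤ.∣ linear i n ∣) → (∀ i → D i * n < p ^ suc K) →
      let floors r C l = floorSum r C n (p ^ suc l) ⦃ p^≢0 (suc l) ⦄ in
      α + t * M + ∑< K (λ l → floors s D l) ≤ ∑< K (λ l → floors r C l) → p ^ α ∣ ℤ.∣ S n ∣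
    excess⇒^∣S α M K n lin small excess =
      atMost-* (∣prodFin∣-atMost p t {λ _ → M} (λ i → ∤⇒atMost pp M (lin i)))
               (∣prodFin∣-atMost p s (λ i → !-atMost-legendre K (D i * n) (small i)))
        α ℤ.∣ S n ∣
        (∣-trans (^-mono-∣ p exponents) (∣-trans (^sumFin∣∣prodFin∣ p r (λ i → ^legendre∣! K (C i * n)))
          (subst (∣∏C!∣ n ∣_) (sym (abs-eq n)) (n∣m*n (∣P∣ n)))))
      where
      open ≤-Reasoning
      exponents : α + (sumFin t (λ _ → M) + sumFin s (λ i → legendre K (D i * n))) ≤ sumFin r (λ i → legendre K (C i * n))
      exponents = begin
        α + (sumFin t (λ _ → M) + sumFin s (λ i → legendre K (D i * n)))
          ≡⟨ cong (α ℕ.+_) (cong₂ _+_ (sumFin-const t M) (sumFin-∑< s K (λ i l → (D i * n) /p^ suc l))) ⟩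
        α + (t * M + _)
          ≡⟨ +-assoc α (t * M) _ ⟨
        α + t * M + _
          ≤⟨ excess ⟩
        _
          ≡⟨ sumFin-∑< r K (λ i l → (C i * n) /p^ suc l) ⟨
        sumFin r (λ i → legendre K (C i * n)) ∎

    -- Digits `m` of `n` raise the valuation of `S n`

    module DigitExcess (ΣC≡ΣD : sumFin r C ≡ sumFin s D) (b : ℕ) (gap : floorSum s D 1 (suc b) < floorSum r C 1 (suc b)) (h′ : ℕ) where

      q : ℕ
      q = p ^ suc h′

      instance
        q≢0 : NonZero q
        q≢0 = p^≢0 (suc h′)

      m : ℕ
      m = suc (q / suc b)

      module _ (large : 2 * suc b * sumFin s D < q) (m<q : m < q) where
        open Digits q m m<q using (digit; occurrences)

        -- By Landau's criterion no level contributes negatively, and every occurrence of the digit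
        -- `m` contributes at least one at its own level.
        occurrences⇒^∣S : ∀ α M B n → ∣P∣ n ≢ 0 → (∀ i → ¬ p ^ M ∣ ℤ.∣ linear i n ∣) →
          α + t * M ≤ occurrences B n → p ^ α ∣ ℤ.∣ S n ∣
        occurrences⇒^∣S α M B n P≢0 lin many = excess⇒^∣S α M K n lin small (begin
          α + t * M + ∑< K Dfloors        ≤⟨ +-monoˡ-≤ (∑< K Dfloors) many ⟩
          occurrences B n + ∑< K Dfloors  ≡⟨ +-comm (occurrences B n) (∑< K Dfloors) ⟩
          ∑< K Dfloors + occurrences B n  ≤⟨ ∑<-block-gain (λ j → ind (digit n j ≟ m)) (λ l → landau P≢0 n (p ^ suc l) ⦃ p^≢0 (suc l) ⦄) gain B (sumFin s D * n) ⟩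
          ∑< K Cfloors                    ∎)
          where
          open ≤-Reasoning
          h = suc h′
          -- The first summand covers the `B` lowest digits in base `q`; the second makes
          -- `p ^ suc K` exceed every `D i * n`.
          K = h * B + sumFin s D * n
          Cfloors Dfloors : ℕ → ℕ
          Cfloors l = floorSum r C n (p ^ suc l) ⦃ p^≢0 (suc l) ⦄
          Dfloors l = floorSum s D n (p ^ suc l) ⦃ p^≢0 (suc l) ⦄
          small : ∀ i → D i * n < p ^ suc K
          small i = begin-strict
            D i * n           ≤⟨ *-monoˡ-≤ n (f[i]≤sumFin s D i) ⟩
            sumFin s D * n    ≤⟨ m≤n+m _ (h * B) ⟩
            K                 <⟨ ≤-refl ⟩
            suc K             <⟨ m<n^m p (ℕ.nonTrivial⇒n>1 p ⦃ prime⇒nonTrivial pp ⦄) (suc K) ⟩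
            p ^ suc K         ∎
          -- Index `l` stands for the modulus `p ^ suc l`, so the last index of block `j` has
          -- modulus `q ^ suc j`, whose leading digit is digit `j`.
          position : ∀ j → p ^ suc (h * j + h′) ≡ q * q ^ j
          position j = trans (cong (p ^_) (trans (sym (+-suc (h * j) h′)) (trans (+-comm (h * j) h) (sym (*-suc h j)))))
            (sym (^-*-assoc p h (suc j)))
          gain : ∀ j → Dfloors (h * j + h′) + ind (digit n j ≟ m) ≤ Cfloors (h * j + h′)
          gain j with digit n j ≟ m
          ... | no _   = subst (_≤ Cfloors (h * j + h′)) (sym (+-identityʳ _)) (landau P≢0 n (p ^ suc (h * j + h′)) ⦃ p^≢0 (suc (h * j + h′)) ⦄)
          ... | yes eq = subst (_≤ Cfloors (h * j + h′)) (+-comm 1 _)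
                (floorSum-digit r s C D ΣC≡ΣD (suc b) gap q (q ^ j) (p ^ suc (h * j + h′)) n
                  ⦃ _ ⦄ ⦃ m^n≢0 q j ⦄ ⦃ p^≢0 (suc (h * j + h′)) ⦄ (position j) large eq)

        module _ (p∤gcd : ∀ i → ¬ p ∣ gcd ℤ.∣ E i ∣ ℤ.∣ F i ∣) where
          open Digits q m m<q using (few-occurrences-rare)

          multiple : ℕ → Fin t → ℕ → ℕ
          multiple M i n = ind (p ^ M ∣? ℤ.∣ linear i n ∣)

          -- With enough digits `m` and no linear factor divisible by `p ^ M`, the valuation bound
          -- gives `p ^ α ∣ S n`. The nonzero value of `P` it requires comes from badness itself, as
          -- a zero of `P` would make `S n` zero.
          bad≤ : ∀ α M B n → bad (p ^ α) n ≤ ind (occurrences B n <? α + t * M) + sumFin t (λ i → multiple M i n)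
          bad≤ α M B n with p ^ α ∣? ℤ.∣ S n ∣
          ... | yes _ = z≤n
          ... | no nd with occurrences B n <? α + t * M
          ...   | yes _ = s≤s z≤n
          ...   | no many with any? (λ i → p ^ M ∣? ℤ.∣ linear i n ∣)
          ...     | yes (i , d) = ≤-trans (ind-mono (yes d) (p ^ M ∣? ℤ.∣ linear i n ∣) id) (f[i]≤sumFin t (λ i → multiple M i n) i)
          ...     | no none = contradiction
                    (occurrences⇒^∣S α M B n (∤S⇒P≢0 nd) (λ i d → none (i , d)) (≮⇒≥ many)) nd

          bad-rare : ∀ α κ → ∃ λ N₀ → ∀ N → N₀ ≤ N → κ * ∑< N (bad (p ^ α)) ≤ 2 * suc t * N
          -- `N` must reach both block lengths `q ^ B` and `p ^ M` for the density bounds. The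
          -- `suc t` exceptional sets, one for the digits and one per linear factor, contribute
          -- `2 * N` each.
          bad-rare α κ = q ^ B + p ^ M , bound
            where
            open ≤-Reasoning
            -- Then `p ^ M` exceeds `κ`, so one hit per block of length `p ^ M` has density below
            -- `1 / κ`.
            M = suc κ
            B = proj₁ (few-occurrences-rare κ (α + t * M))
            few : ℕ → ℕ
            few n = ind (occurrences B n <? α + t * M)

            few-rare : ∀ Y → κ * ∑< (q ^ B * Y) few ≤ q ^ B * Y
            few-rare = proj₂ (few-occurrences-rare κ (α + t * M))

            multiple-rare : ∀ i Y → κ * ∑< (p ^ M * Y) (multiple M i) ≤ p ^ M * Y
            multiple-rare i Y = *-mono-≤
              (≤-trans (n≤1+n κ) (<⇒≤ (m<n^m p (ℕ.nonTrivial⇒n>1 p ⦃ prime⇒nonTrivial pp ⦄) M)))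
              (linear-multiples-rare pp (E i) (F i) (p∤gcd i) κ Y)

            total : ∀ t N → 2 * N + t * (2 * N) ≡ 2 * suc t * N
            total = solve-∀

            bound : ∀ N → q ^ B + p ^ M ≤ N → κ * ∑< N (bad (p ^ α)) ≤ 2 * suc t * N
            bound N N₀≤N = begin
              κ * ∑< N (bad (p ^ α))
                ≤⟨ *-monoʳ-≤ κ (∑<-mono N (λ n _ → bad≤ α M B n)) ⟩
              κ * ∑< N (λ n → few n + sumFin t (λ i → multiple M i n))
                ≡⟨ cong (κ *_) (∑<-+ N few (λ n → sumFin t (λ i → multiple M i n))) ⟩
              κ * (∑< N few + ∑< N (λ n → sumFin t (λ i → multiple M i n)))
                ≡⟨ cong (λ x → κ * (∑< N few + x)) (sumFin-∑< t N (multiple M)) ⟨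
              κ * (∑< N few + sumFin t (λ i → ∑< N (multiple M i)))
                ≡⟨ *-distribˡ-+ κ (∑< N few) (sumFin t (λ i → ∑< N (multiple M i))) ⟩
              κ * ∑< N few + κ * sumFin t (λ i → ∑< N (multiple M i))
                ≡⟨ cong (κ * ∑< N few ℕ.+_) (trans (*-comm κ (sumFin t (λ i → ∑< N (multiple M i))))
                     (sym (sumFin-*ʳ t (λ i → ∑< N (multiple M i)) κ))) ⟩
              κ * ∑< N few + sumFin t (λ i → ∑< N (multiple M i) * κ)
                ≤⟨ +-mono-≤
                     (block-density⇒density κ (q ^ B) ⦃ m^n≢0 q B ⦄ few few-rare N (≤-trans (m≤m+n (q ^ B) (p ^ M)) N₀≤N))
                     (sumFin-mono t (λ i → subst (_≤ 2 * N) (*-comm κ (∑< N (multiple M i)))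
                       (block-density⇒density κ (p ^ M) ⦃ p^≢0 M ⦄ (multiple M i) (multiple-rare i) N
                         (≤-trans (m≤n+m (p ^ M) (q ^ B)) N₀≤N)))) ⟩
              2 * N + sumFin t (λ _ → 2 * N)
                ≡⟨ cong (2 * N ℕ.+_) (sumFin-const t (2 * N)) ⟩
              2 * N + t * (2 * N)
                ≡⟨ total t N ⟩
              2 * suc t * N ∎

-- Choice of parameters and conclusion

-- Otherwise `2 k ≤ q ≤ k + 1` for `k = q / b`, which forces `k ≤ 1` and `q ≤ 2`.
digit-bound : ∀ q b → 1 < b → 2 < q → .⦃ _ : NonZero b ⦄ → suc (q / b) < q
digit-bound q b 1<b 2<q = ≰⇒> λ q≤1+k → <⇒≱ 2<q (≤-trans q≤1+k (s≤s (k≤1 q≤1+k)))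
  where
  open ≤-Reasoning
  k = q / b
  k≤1 : q ≤ suc k → k ≤ 1
  k≤1 q≤1+k = +-cancelˡ-≤ k k 1 (begin
    k + k    ≡⟨ cong (k ℕ.+_) (+-identityʳ k) ⟨
    2 * k    ≤⟨ *-monoˡ-≤ k 1<b ⟩
    b * k    ≡⟨ *-comm b k ⟩
    k * b    ≤⟨ m/n*n≤m q b ⟩
    q        ≤⟨ q≤1+k ⟩
    suc k    ≡⟨ +-comm 1 k ⟩
    k + 1    ∎)

floorSum-1-1 : ∀ r C → floorSum r C 1 1 ≡ sumFin r C
floorSum-1-1 r C = sumFin-cong r (λ i → trans (n/1≡n (C i * 1)) (*-identityʳ (C i)))

-- At denominator 1 the floor sums are the full coefficient sums, which agree, so no gap can occur
-- there.
floorSum-gap⇒1<b : ∀ r s C D → sumFin r C ≡ sumFin s D → ∀ b → floorSum s D 1 (suc b) < floorSum r C 1 (suc b) → 1 < suc b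
floorSum-gap⇒1<b r s C D ΣC≡ΣD (suc b) gap = s≤s (s≤s z≤n)
floorSum-gap⇒1<b r s C D ΣC≡ΣD zero    gap =
  contradiction (trans (floorSum-1-1 s D) (trans (sym ΣC≡ΣD) (sym (floorSum-1-1 r C)))) (<⇒≢ gap)

exponent-above : ∀ p → 1 < p → ∀ B → ∃ λ h → B < p ^ suc h
exponent-above p 1<p B = B , <-trans ≤-refl (m<n^m p 1<p (suc B))

theorem2 : (p α : ℕ) → Prime p → 0 < α → (P : List ℤ)
    → (r s t : ℕ) (C : Fin r → ℕ) (D : Fin s → ℕ) (E F : Fin t → ℤ)
    → (∀ i → 0 < C i) → (∀ i → 0 < D i)
    → (∀ i → ¬ (p ∣ gcd ℤ.∣ E i ∣ ℤ.∣ F i ∣))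
    → sumFin r C ≡ sumFin s D
    → ¬ SameSet C D
    → (∀ (n : ℕ) (i : Fin t) → ¬ (E i ℤ.* (+ n) ℤ.+ F i ≡ + 0))
    → (S : ℕ → ℤ)
    → (∀ n → S n ℤ.* denom s D t E F n ≡ numer P r C n)
    → ∀ (k : ℕ) → 0 < k
    → ∃ λ N₀ → ∀ N → N₀ ≤ N → k ℕ.* (N ∸ countDiv (p ^ α) S N) ≤ N
theorem2 p α pp _ P r s t C D E F C>0 D>0 p∤gcd ΣC≡ΣD ≠set lin≢0 S S-eq k _
  with ∃floorSum≢ r s C D C>0 D>0 ΣC≡ΣD ≠set
... | b , neq with <-cmp (floorSum s D 1 (suc b)) (floorSum r C 1 (suc b))
...   | tri≈ _ eq _  = contradiction (sym eq) neq
-- A negative value contradicts Landau's criterion wherever `P` is nonzero; elsewhere `S n` is zero.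
-- So no `n` is bad, and `N₀ = 0` works.
...   | tri> _ _ neg = 0 , λ N _ → subst (λ x → k * x ≤ N) (sym (trans (N∸countDiv (p ^ α) N) (none N)))
                                     (≤-trans (≤-reflexive (*-zeroʳ k)) z≤n)
  where
  open IntegralQuotient P r s t C D E F S S-eq lin≢0
  never : ∀ n → bad (p ^ α) n ≡ 0
  never n with p ^ α ∣? ℤ.∣ S n ∣
  ... | yes _ = refl
  ... | no nd = contradiction neg (≤⇒≯ (landau (∤S⇒P≢0 nd) 1 (suc b)))
  none : ∀ N → ∑< N (bad (p ^ α)) ≡ 0
  none N = trans (∑<-cong N never) (trans (∑<-const N 0) (*-zeroʳ N))
-- The bound serves two purposes: `q > 2` makes `m` a genuine digit, and `q` above `2 (b + 1)` times
-- the sum of `D` confines the fractional part to the interval of the gap.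
...   | tri< gap _ _ with exponent-above p (ℕ.nonTrivial⇒n>1 p ⦃ prime⇒nonTrivial pp ⦄) (2 + 2 * suc b * sumFin s D)
...     | h′ , h<q = N₀ , λ N N₀≤N → subst (λ x → k * x ≤ N) (sym (N∸countDiv (p ^ α) N))
                       (*-cancelˡ-≤ (2 * suc t) (subst (_≤ 2 * suc t * N) (*-assoc (2 * suc t) k _) (rare N N₀≤N)))
  where
  open IntegralQuotient P r s t C D E F S S-eq lin≢0
  open DigitExcess pp ΣC≡ΣD b gap h′ using (q; m; bad-rare)
  m<q : m < q
  m<q = digit-bound q (suc b) (floorSum-gap⇒1<b r s C D ΣC≡ΣD b gap) (≤-<-trans (m≤m+n 2 _) h<q)
  -- Rarity is requested with constant `2 * suc t * k`, so that the factor `2 * suc t` cancels and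
  -- `k` remains.
  few-bad : ∃ λ N₀ → ∀ N → N₀ ≤ N → 2 * suc t * k * ∑< N (bad (p ^ α)) ≤ 2 * suc t * N
  few-bad = bad-rare (≤-<-trans (m≤n+m _ 2) h<q) m<q p∤gcd α (2 * suc t * k)
  N₀ = proj₁ few-bad
  rare = proj₂ few-bad
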